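{- Let $r\ge 2$. Every $n$-vertex $r$-graph $G$ with $e\ge n^{r-1/6^{r-1}}$ edges contains $\frac{1}{6r}(e/n)^{1/r}$ vertex-disjoint copies of the complete $r$-partite $r$-graph $K_r(s,\dots,s,t)$, where $s=\frac{1}{12}\Big(\frac{\log n}{\log(n^r/e)}\Big)^{1/(r-1)}$ and $t=n^{1/r}$.
   Context: An $r$-graph is an $r$-uniform hypergraph. $K_r(a_1,\dots,a_r)$ is the complete $r$-partite $r$-graph with vertex classes of sizes $a_1,\dots,a_r$, whose edges are all $r$-sets with exactly one vertex in each class; $K_r(s,\dots,s,t)$ has $r-1$ classes of size $s$ and one of size $t$. Non-integer quantities are rounded (floors and ceilings omitted); $n$ is assumed sufficiently large. -}

module Defs where

open import Data.Nat using (ℕ; _<ᵇ_; _∸_)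
open import Data.Bool using (if_then_else_)
open import Data.Fin using (Fin; toℕ)
open import Data.Fin.Subset using (Subset; ⁅_⁆; ⋃; ∣_∣)
open import Data.List using (List; map; length; allFin)
open import Data.List.Relation.Unary.All using (All)
open import Data.List.Relation.Unary.Unique.Propositional using (Unique)
open import Data.List.Membership.Propositional using (_∈_)
open import Data.Product using (Σ; _×_)
open import Relation.Binary.PropositionalEquality using (_≡_)
open import Function.Definitions using (Injective)

record RGraph (r n : ℕ) : Set where
  field
    edges   : List (Subset n)
    uniform : All (λ E → ∣ E ∣ ≡ r) edges
    simple  : Unique edges
open RGraph public

edgeCount : ∀ {r n} → RGraph r n → ℕ
edgeCount G = length (edges G)

image : ∀ {r n} → (Fin r → Fin n) → Subset n
image {r} f = ⋃ (map (λ i → ⁅ f i ⁆) (allFin r))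

classSize : (r s t : ℕ) → Fin r → ℕ
classSize r s t i = if toℕ i <ᵇ r ∸ 1 then s else t

KVert : (r s t : ℕ) → Set
KVert r s t = Σ (Fin r) (λ i → Fin (classSize r s t i))

-- k vertex-disjoint copies of K_r(s,…,s,t) in G: a jointly injective map
-- from k disjoint copies of the vertex set of K_r(s,…,s,t) into V(G) = Fin n
-- such that, in each copy, every transversal r-set (one vertex from each
-- class) is an edge of G.
HasDisjointCopies : ∀ {r n} → RGraph r n → (k s t : ℕ) → Set
HasDisjointCopies {r} {n} G k s t =
  Σ (Fin k × KVert r s t → Fin n) λ φ →
    Injective _≡_ _≡_ φ ×
    (∀ (j : Fin k) (c : (i : Fin r) → Fin (classSize r s t i)) →
       image {r} {n} (λ i → φ (j Data.Product., (i Data.Product., c i))) ∈ edges G)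

{-# OPTIONS --safe #-}
module Submission where

-- Write an r-graph as a 0/1 weight on r-tuples of vertices and fix a colouring of the vertices by
-- the r positions for which at least e r!/r^r tuples are rainbow. Greedily removing copies of
-- K_r(s,…,s,t) is cheap on the s-classes, but deleting kt vertices of high degree could destroy
-- all edges. So first charge each rainbow tuple to one of its vertices such that no vertex is
-- charged more than m^((r-1)/r) times, m the number of rainbow tuples, keep the tuples charged to
-- the most popular position, and let only that position receive the t-classes. Then
-- kt ≤ e^(1/r)/(6r) deleted vertices destroy at most (e/m)^(1/r) m/(6r) ≤ m/(2r) of the at least
-- m/r tuples, because r^r ≤ 3^r r!. What survives always has density of order e/n^r, and a
-- Kővári–Sós–Turán argument finds the next copy in it.

open import Defs
open import Data.Bool using (true; false; if_then_else_; T)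
open import Data.Fin using (Fin; zero; suc; toℕ; fromℕ; fromℕ<; inject₁; inject≤; combine; punchIn; punchOut)
import Data.Fin as Fin
import Data.Fin.Properties as Fin
open import Data.Fin.Relation.Unary.Top using (view; ‵fromℕ; ‵inject₁)
open import Data.Fin.Subset using (Subset; inside; outside; ⁅_⁆; ⋃; ∣_∣; _-_)
  renaming (_∈_ to _∈ₛ_; _∉_ to _∉ₛ_)
open import Data.Fin.Subset.Properties
  using (_∈?_; p─⊥≡p; ⊆-antisym; x∈p∪q⁻; x∈p∪q⁺; x∈⁅x⁆; x∈⁅y⁆⇒x≡y; ∉⊥; p─q⊆p; x∈p∧x∉q⇒x∈p─q)
open import Data.List
  using (List; []; _∷_; _++_; map; length; allFin; tabulate; cartesianProduct; cartesianProductWith)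
open import Data.List.Membership.Propositional using (_∈_)
open import Data.List.Membership.Propositional.Properties using (∈-allFin; ∈-map⁺; ∈-map⁻)
open import Data.List.Properties using (length-tabulate)
open import Data.List.Relation.Unary.All as All using (All; []; _∷_)
open import Data.List.Relation.Unary.AllPairs using ([]; _∷_)
open import Data.List.Relation.Unary.Any using (here; there)
open import Data.List.Relation.Unary.Unique.Propositional using (Unique)
open import Data.List.Relation.Unary.Unique.Propositional.Properties using (allFin⁺)
open import Data.Nat using (ℕ; zero; suc; _+_; _*_; _∸_; _^_; _!; _/_; _%_; _≤_; _<_; _≤?_; _<?_; _<ᵇ_;
  z≤n; s≤s; s≤s⁻¹; NonZero; >-nonZero)
open import Data.Nat.DivMod using (m≡m%n+[m/n]*n; m%n<n; m/n*n≤m)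
open import Data.Nat.Properties
open import Data.Nat.Tactic.RingSolver using (solve-∀)
open import Algebra.Properties.CommutativeSemigroup *-commutativeSemigroup
  using () renaming (x∙yz≈y∙xz to *-swapˡ; interchange to *-interchange)
open import Algebra.Properties.CommutativeSemigroup +-commutativeSemigroup
  using () renaming (interchange to +-interchange)
open import Data.Product using (∃; ∃-syntax; _×_; _,_; proj₁; proj₂; map₂)
open import Data.Sum using (_⊎_; inj₁; inj₂)
open import Data.Unit using (tt)
open import Data.Vec as Vec using (Vec; []; _∷_; lookup; insertAt)
open import Data.Vec.Properties using (insertAt-lookup; insertAt-punchIn; lookup∘tabulate)
open import Function using (_∘_; id)
open import Relation.Binary.PropositionalEquality
open import Relation.Nullary using (Dec; yes; no; ¬_; contradiction; does; _because_)
open import Relation.Nullary.Decidable using (_⊎-dec_)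

-- With the logarithms cleared and M = n^r, the choice of s says (M/e)^((12 s)^(r-1)) ≤ n, so
-- auxiliary quantities are measured as powers of M/e. The Kővári-Sós-Turán argument tracks a
-- density 3/(2Q). Fixing one s-class raises Q to the power s + 1 up to a constant, and s + 1 ≤ 2s.
-- The r - 1 rounds thus spend a factor (2 s)^(r-1) of the exponent (12 s)^(r-1); the other factor
-- 6^(r-1) pays for squaring the result and, for r ≥ 3, for the constants. The square is there
-- because t ≤ n^(1/r) ≤ n^(1/2), so the final Q has to stay below about n^(1/2). The colouring has
-- a second use: vertices of different classes get different colours, so the greedy search can keep
-- track of used vertices class by class.

private variable
  A B : Set

-- Positivity of products, and indicators of decidable propositions

0<m*n⇒0<m : ∀ m {n} → 0 < m * n → 0 < m
0<m*n⇒0<m (suc m) _ = s≤s z≤n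

0<m*n⇒0<n : ∀ m {n} → 0 < m * n → 0 < n
0<m*n⇒0<n m {n} p = 0<m*n⇒0<m n (subst (0 <_) (*-comm m n) p)

*-pos : ∀ {m n} → 0 < m → 0 < n → 0 < m * n
*-pos = *-mono-≤

*-≤1 : ∀ {m n} → m ≤ 1 → n ≤ 1 → m * n ≤ 1
*-≤1 = *-mono-≤

≤1-bound : ∀ {m n} → m ≤ 1 → (0 < m → 0 < n) → m ≤ n
≤1-bound {zero}  _ _ = z≤n
≤1-bound {suc _} p f = ≤-trans p (f (s≤s z≤n))

𝟙 : ∀ {P : Set} → Dec P → ℕ
𝟙 d = if does d then 1 else 0

𝟙≤1 : ∀ {P : Set} (d : Dec P) → 𝟙 d ≤ 1
𝟙≤1 (true because _)  = s≤s z≤n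
𝟙≤1 (false because _) = z≤n

𝟙⁻ : ∀ {P : Set} (d : Dec P) → 0 < 𝟙 d → P
𝟙⁻ (yes p) _ = p

𝟙⁺ : ∀ {P : Set} (d : Dec P) → P → 0 < 𝟙 d
𝟙⁺ (yes _) _ = s≤s z≤n
𝟙⁺ (no ¬p) p = contradiction p ¬p

𝟙-yes : ∀ {P : Set} (d : Dec P) → P → 𝟙 d ≡ 1
𝟙-yes (yes _) _ = refl
𝟙-yes (no ¬p) p = contradiction p ¬p

-- Finite sums

∑ : List A → (A → ℕ) → ℕ
∑ []       F = 0
∑ (x ∷ xs) F = F x + ∑ xs F

∑-mono : ∀ (xs : List A) {F G : A → ℕ} → (∀ x → F x ≤ G x) → ∑ xs F ≤ ∑ xs G
∑-mono []       F≤G = z≤n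
∑-mono (x ∷ xs) F≤G = +-mono-≤ (F≤G x) (∑-mono xs F≤G)

∑-cong : ∀ (xs : List A) {F G : A → ℕ} → (∀ x → F x ≡ G x) → ∑ xs F ≡ ∑ xs G
∑-cong []       F≡G = refl
∑-cong (x ∷ xs) F≡G = cong₂ _+_ (F≡G x) (∑-cong xs F≡G)

∑-+ : ∀ (xs : List A) (F G : A → ℕ) → ∑ xs (λ x → F x + G x) ≡ ∑ xs F + ∑ xs G
∑-+ []       F G = refl
∑-+ (x ∷ xs) F G = trans (cong (F x + G x +_) (∑-+ xs F G)) (+-interchange (F x) (G x) _ _)

∑-*ˡ : ∀ c (xs : List A) (F : A → ℕ) → ∑ xs (λ x → c * F x) ≡ c * ∑ xs F
∑-*ˡ c []       F = sym (*-zeroʳ c)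
∑-*ˡ c (x ∷ xs) F = trans (cong (c * F x +_) (∑-*ˡ c xs F)) (sym (*-distribˡ-+ c (F x) _))

∑-*ʳ : ∀ c (xs : List A) (F : A → ℕ) → ∑ xs (λ x → F x * c) ≡ ∑ xs F * c
∑-*ʳ c xs F = trans (∑-cong xs (λ x → *-comm (F x) c)) (trans (∑-*ˡ c xs F) (*-comm c _))

∑-All-const : ∀ {xs : List A} {F : A → ℕ} {c} → All (λ x → F x ≡ c) xs → ∑ xs F ≡ length xs * c
∑-All-const []         = refl
∑-All-const (eq ∷ eqs) = cong₂ _+_ eq (∑-All-const eqs)

∑-const : ∀ (xs : List A) c → ∑ xs (λ _ → c) ≡ length xs * c
∑-const xs c = ∑-All-const (All.universal (λ _ → refl) xs)

∑-zero : ∀ (xs : List A) → ∑ xs (λ _ → 0) ≡ 0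
∑-zero xs = trans (∑-const xs 0) (*-zeroʳ (length xs))

∑-swap : ∀ (xs : List A) (ys : List B) (F : A → B → ℕ) →
  ∑ xs (λ x → ∑ ys (F x)) ≡ ∑ ys (λ y → ∑ xs (λ x → F x y))
∑-swap []       ys F = sym (∑-zero ys)
∑-swap (x ∷ xs) ys F =
  trans (cong (∑ ys (F x) +_) (∑-swap xs ys F)) (sym (∑-+ ys (F x) _))

∑-++ : ∀ (xs ys : List A) (F : A → ℕ) → ∑ (xs ++ ys) F ≡ ∑ xs F + ∑ ys F
∑-++ []       ys F = refl
∑-++ (x ∷ xs) ys F = trans (cong (F x +_) (∑-++ xs ys F)) (sym (+-assoc (F x) _ _))

∑-map : ∀ (f : A → B) (xs : List A) (F : B → ℕ) → ∑ (map f xs) F ≡ ∑ xs (F ∘ f)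
∑-map f []       F = refl
∑-map f (x ∷ xs) F = cong (F (f x) +_) (∑-map f xs F)

∑-cartesianProductWith : ∀ {C : Set} (f : A → B → C) xs ys (F : C → ℕ) →
  ∑ (cartesianProductWith f xs ys) F ≡ ∑ xs (λ x → ∑ ys (λ y → F (f x y)))
∑-cartesianProductWith f []       ys F = refl
∑-cartesianProductWith f (x ∷ xs) ys F =
  trans (∑-++ (map (f x) ys) _ F)
        (cong₂ _+_ (∑-map (f x) ys F) (∑-cartesianProductWith f xs ys F))

∑-∈ : ∀ {xs : List A} (F : A → ℕ) {x} → x ∈ xs → F x ≤ ∑ xs F
∑-∈ F (here refl)            = m≤m+n _ _
∑-∈ F (there {x = y} x∈xs)   = ≤-trans (∑-∈ F x∈xs) (m≤n+m _ (F y))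

∑-pos : ∀ (xs : List A) {F : A → ℕ} → 0 < ∑ xs F → ∃ λ x → x ∈ xs × 0 < F x
∑-pos (x ∷ xs) {F} p with 0 <? F x
... | yes q = x , here refl , q
... | no ¬q with ∑-pos xs (subst (λ z → 0 < z + ∑ xs F) (n≤0⇒n≡0 (≮⇒≥ ¬q)) p)
...   | y , y∈ , q = y , there y∈ , q

∑-unique≤1 : ∀ {xs : List A} {F : A → ℕ} → Unique xs → (∀ x → F x ≤ 1) →
  (∀ {x y} → x ∈ xs → y ∈ xs → 0 < F x → 0 < F y → x ≡ y) → ∑ xs F ≤ 1
∑-unique≤1 {xs = []} _ _ _ = z≤n
∑-unique≤1 {xs = x ∷ xs} {F} (x∉xs ∷ u) F≤1 single with 0 <? F x
... | no ¬q = subst (λ z → z + ∑ xs F ≤ 1) (sym (n≤0⇒n≡0 (≮⇒≥ ¬q)))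
    (∑-unique≤1 u F≤1 (λ x∈ y∈ → single (there x∈) (there y∈)))
... | yes q with 0 <? ∑ xs F
...   | no ¬r = subst (λ z → F x + z ≤ 1) (sym (n≤0⇒n≡0 (≮⇒≥ ¬r)))
                  (subst (_≤ 1) (sym (+-identityʳ (F x))) (F≤1 x))
...   | yes r with ∑-pos xs r
...     | y , y∈ , q′ = contradiction (single (here refl) (there y∈) q q′) (All.lookup x∉xs y∈)

∑-pigeonhole : ∀ (xs : List A) {F : A → ℕ} {c} → 0 < length xs →
  length xs * c ≤ ∑ xs F → ∃ λ x → c ≤ F x
∑-pigeonhole {A = A} (x ∷ xs) {F} {c} _ = go x xs
  where
  go : ∀ (x : A) xs → c + length xs * c ≤ F x + ∑ xs F → ∃ λ y → c ≤ F y
  go x xs p with c ≤? F x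
  go x xs       p | yes q = x , q
  go x []       p | no ¬q = contradiction (subst₂ _≤_ (+-identityʳ c) (+-identityʳ _) p) ¬q
  go x (y ∷ xs) p | no ¬q = go y xs
    (+-cancelˡ-≤ c _ _ (≤-trans p (+-monoˡ-≤ _ (<⇒≤ (≰⇒> ¬q)))))

∑-tabulate : ∀ {n} (g : Fin n → A) (F : A → ℕ) → ∑ (tabulate g) F ≡ ∑ (allFin n) (F ∘ g)
∑-tabulate {n = zero}  g F = refl
∑-tabulate {n = suc n} g F =
  cong (F (g zero) +_) (trans (∑-tabulate (g ∘ suc) F) (sym (∑-tabulate suc (F ∘ g))))

length-allFin : ∀ n → length (allFin n) ≡ n
length-allFin n = length-tabulate id

∑-≟ : ∀ {n} (b : Fin n) → ∑ (allFin n) (λ a → 𝟙 (a Fin.≟ b)) ≤ 1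
∑-≟ {n} b = ∑-unique≤1 (allFin⁺ n) (λ a → 𝟙≤1 (a Fin.≟ b))
  (λ {x} {y} _ _ p q → trans (𝟙⁻ (x Fin.≟ b) p) (sym (𝟙⁻ (y Fin.≟ b) q)))

∑-allFin-pigeonhole : ∀ n {F : Fin n → ℕ} {c} → 0 < n →
  n * c ≤ ∑ (allFin n) F → ∃ λ x → c ≤ F x
∑-allFin-pigeonhole n {F} {c} 0<n p = ∑-pigeonhole (allFin n)
  (subst (0 <_) (sym (length-allFin n)) 0<n)
  (subst (λ l → l * c ≤ ∑ (allFin n) F) (sym (length-allFin n)) p)

-- Sums over tuples of vertices

tuples : ∀ n j → List (Vec (Fin n) j)
tuples n zero    = [] ∷ []
tuples n (suc j) = cartesianProductWith _∷_ (allFin n) (tuples n j)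

∑-tuples-suc : ∀ n j (F : Vec (Fin n) (suc j) → ℕ) →
  ∑ (tuples n (suc j)) F ≡ ∑ (allFin n) (λ a → ∑ (tuples n j) (λ w → F (a ∷ w)))
∑-tuples-suc n j F = ∑-cartesianProductWith _∷_ (allFin n) (tuples n j) F

∑-tuples-const : ∀ n j c → ∑ (tuples n j) (λ _ → c) ≡ n ^ j * c
∑-tuples-const n zero    c = refl
∑-tuples-const n (suc j) c = begin
  ∑ (tuples n (suc j)) (λ _ → c)                 ≡⟨ ∑-tuples-suc n j _ ⟩
  ∑ (allFin n) (λ _ → ∑ (tuples n j) (λ _ → c))  ≡⟨ ∑-const (allFin n) _ ⟩
  length (allFin n) * ∑ (tuples n j) (λ _ → c)   ≡⟨ cong₂ _*_ (length-allFin n) (∑-tuples-const n j c) ⟩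
  n * (n ^ j * c)                                ≡⟨ *-assoc n _ c ⟨
  n * n ^ j * c                                  ∎
  where open ≡-Reasoning

-- Isolates one coordinate: the class that receives the t vertices may sit at any position, while
-- the search for a copy always treats it last.
∑-insertAt : ∀ n j (i : Fin (suc j)) (F : Vec (Fin n) (suc j) → ℕ) →
  ∑ (tuples n (suc j)) F ≡ ∑ (tuples n j) (λ w → ∑ (allFin n) (λ a → F (insertAt w i a)))
∑-insertAt n j zero F = trans (∑-tuples-suc n j F) (∑-swap (allFin n) (tuples n j) _)
∑-insertAt n (suc j) (suc i) F = begin
  ∑ (tuples n (2 + j)) F
    ≡⟨ ∑-tuples-suc n (suc j) F ⟩
  ∑ (allFin n) (λ b → ∑ (tuples n (suc j)) (λ x → F (b ∷ x)))
    ≡⟨ ∑-cong (allFin n) (λ b → ∑-insertAt n j i (λ x → F (b ∷ x))) ⟩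
  ∑ (allFin n) (λ b → ∑ (tuples n j) (λ w → ∑ (allFin n) (λ a → F (b ∷ insertAt w i a))))
    ≡⟨ ∑-tuples-suc n j _ ⟨
  ∑ (tuples n (suc j)) (λ w → ∑ (allFin n) (λ a → F (insertAt w (suc i) a)))
    ∎
  where open ≡-Reasoning

-- Finite products

∏ : ∀ {n} → (Fin n → ℕ) → ℕ
∏ {zero}  u = 1
∏ {suc n} u = u zero * ∏ (u ∘ suc)

∏-mono : ∀ {n} {u v : Fin n → ℕ} → (∀ i → u i ≤ v i) → ∏ u ≤ ∏ v
∏-mono {zero}  u≤v = ≤-refl
∏-mono {suc n} u≤v = *-mono-≤ (u≤v zero) (∏-mono (u≤v ∘ suc))

∏-const : ∀ n c → ∏ {n} (λ _ → c) ≡ c ^ n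
∏-const zero    c = refl
∏-const (suc n) c = cong (c *_) (∏-const n c)

∏-≤^ : ∀ {n} {u : Fin n → ℕ} {c} → (∀ i → u i ≤ c) → ∏ u ≤ c ^ n
∏-≤^ {n} u≤c = ≤-trans (∏-mono u≤c) (≤-reflexive (∏-const n _))

∏-pos : ∀ {n} {u : Fin n → ℕ} → (∀ i → 0 < u i) → 0 < ∏ u
∏-pos {zero}  p = s≤s z≤n
∏-pos {suc n} p = *-pos (p zero) (∏-pos (p ∘ suc))

∏-pos⁻ : ∀ {n} {u : Fin n → ℕ} → 0 < ∏ u → ∀ i → 0 < u i
∏-pos⁻ {suc n} {u} p zero    = 0<m*n⇒0<m (u zero) p
∏-pos⁻ {suc n} {u} p (suc i) = ∏-pos⁻ (0<m*n⇒0<n (u zero) p) i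

∏-∈ : ∀ {n} {u : Fin n → ℕ} → (∀ i → 0 < u i) → ∀ i → u i ≤ ∏ u
∏-∈ {suc n} {u} p zero    = subst (_≤ ∏ u) (*-identityʳ (u zero)) (*-monoʳ-≤ (u zero) (∏-pos (p ∘ suc)))
∏-∈ {suc n} {u} p (suc i) = ≤-trans (∏-∈ (p ∘ suc) i)
  (subst (_≤ ∏ u) (*-identityˡ _) (*-monoˡ-≤ _ (p zero)))

∏-swap : ∀ {m n} (h : Fin m → Fin n → ℕ) →
  ∏ (λ i → ∏ (h i)) ≡ ∏ (λ k → ∏ (λ i → h i k))
∏-swap {zero} {n} h = sym (trans (∏-const n 1) (^-zeroˡ n))
∏-swap {suc m} {n} h =
  trans (cong (∏ (h zero) *_) (∏-swap (h ∘ suc))) (sym (∏-* (h zero) _))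
  where
  ∏-* : ∀ {n} (u v : Fin n → ℕ) → ∏ (λ i → u i * v i) ≡ ∏ u * ∏ v
  ∏-* {zero}  u v = refl
  ∏-* {suc n} u v = trans (cong (u zero * v zero *_) (∏-* (u ∘ suc) (v ∘ suc)))
    (*-interchange (u zero) (v zero) _ _)

∏-except : ∀ {j} {u : Fin (suc j) → ℕ} {c} i → u i ≤ 1 → (∀ l → l ≢ i → u l ≤ c) → ∏ u ≤ c ^ j
∏-except {j} {u} zero p q =
  ≤-trans (*-mono-≤ p (∏-≤^ (λ l → q (suc l) (λ ())))) (≤-reflexive (*-identityˡ _))
∏-except {suc j} (suc i) p q =
  *-mono-≤ (q zero (λ ())) (∏-except i p (λ l l≢i → q (suc l) (l≢i ∘ Fin.suc-injective)))

∏-single : ∀ {n} {u : Fin n → ℕ} i → (∀ l → l ≢ i → u l ≤ 1) → ∏ u ≤ u i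
∏-single {suc n} {u} zero q = ≤-trans
  (*-monoʳ-≤ (u zero) (≤-trans (∏-≤^ {c = 1} (λ l → q (suc l) (λ ()))) (≤-reflexive (^-zeroˡ n))))
  (≤-reflexive (*-identityʳ _))
∏-single {suc n} (suc i) q = ≤-trans
  (*-mono-≤ (q zero (λ ())) (∏-single i (λ l l≢i → q (suc l) (l≢i ∘ Fin.suc-injective))))
  (≤-reflexive (*-identityˡ _))

∑-∏ : ∀ n r (G : Fin r → Fin n → ℕ) →
  ∑ (tuples n r) (λ x → ∏ (λ i → G i (lookup x i))) ≡ ∏ (λ i → ∑ (allFin n) (G i))
∑-∏ n zero    G = refl
∑-∏ n (suc r) G = begin
  ∑ (tuples n (suc r)) (λ x → ∏ (λ i → G i (lookup x i)))
    ≡⟨ ∑-tuples-suc n r _ ⟩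
  ∑ (allFin n) (λ a → ∑ (tuples n r) (λ w → G zero a * ∏ (λ i → G (suc i) (lookup w i))))
    ≡⟨ ∑-cong (allFin n) (λ a → trans (∑-*ˡ (G zero a) (tuples n r) _)
         (cong (G zero a *_) (∑-∏ n r (G ∘ suc)))) ⟩
  ∑ (allFin n) (λ a → G zero a * ∏ (λ i → ∑ (allFin n) (G (suc i))))
    ≡⟨ ∑-*ʳ _ (allFin n) (G zero) ⟩
  ∏ (λ i → ∑ (allFin n) (G i))
    ∎
  where open ≡-Reasoning

-- `F` is dominated by a product of one indicator per coordinate, with the indicator of `y` at
-- position `i`. The sum of such a product factorises, and position `i` contributes at most 1.
∑-fibre : ∀ {n j} (F : Vec (Fin n) (suc j) → ℕ) (G : Fin (suc j) → Fin n → ℕ) i y {c} →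
  (∀ x → F x ≤ 1) → (∀ x → 0 < F x → lookup x i ≡ y × (∀ l → l ≢ i → 0 < G l (lookup x l))) →
  (∀ l → l ≢ i → ∑ (allFin n) (G l) ≤ c) → ∑ (tuples n (suc j)) F ≤ c ^ j
∑-fibre {n} {j} F G i y {c} F≤1 F⇒G G≤c = begin
  ∑ (tuples n (suc j)) F
    ≤⟨ ∑-mono (tuples n (suc j)) (λ x → ≤1-bound (F≤1 x) (λ p → ∏-pos (pos x p))) ⟩
  ∑ (tuples n (suc j)) (λ x → ∏ (λ l → G′ l (lookup x l)))
    ≡⟨ ∑-∏ n (suc j) G′ ⟩
  ∏ (λ l → ∑ (allFin n) (G′ l))
    ≤⟨ ∏-except i at-i off-i ⟩
  c ^ j ∎
  where
  open ≤-Reasoning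
  G′ : Fin (suc j) → Fin n → ℕ
  G′ l a with l Fin.≟ i
  ... | yes _ = 𝟙 (a Fin.≟ y)
  ... | no  _ = G l a
  pos : ∀ x → 0 < F x → ∀ l → 0 < G′ l (lookup x l)
  pos x p l with l Fin.≟ i
  ... | yes refl = 𝟙⁺ (lookup x l Fin.≟ y) (proj₁ (F⇒G x p))
  ... | no  l≢i  = proj₂ (F⇒G x p) l l≢i
  at-i : ∑ (allFin n) (G′ i) ≤ 1
  at-i with i Fin.≟ i
  ... | yes _  = ∑-≟ y
  ... | no i≢i = contradiction refl i≢i
  off-i : ∀ l → l ≢ i → ∑ (allFin n) (G′ l) ≤ c
  off-i l l≢i with l Fin.≟ i
  ... | yes l≡i = contradiction l≡i l≢i
  ... | no  _   = G≤c l l≢i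

-- Edges as vertex tuples, and rainbow colourings

private variable
  n j : ℕ

∈-⋃⁻ : ∀ {x : Fin n} (ps : List (Subset n)) → x ∈ₛ ⋃ ps → ∃ λ p → p ∈ ps × x ∈ₛ p
∈-⋃⁻ []       x∈ = contradiction x∈ ∉⊥
∈-⋃⁻ (p ∷ ps) x∈ with x∈p∪q⁻ p (⋃ ps) x∈
... | inj₁ x∈p = p , here refl , x∈p
... | inj₂ x∈⋃ with ∈-⋃⁻ ps x∈⋃
...   | q , q∈ , x∈q = q , there q∈ , x∈q

∈-⋃⁺ : ∀ {x : Fin n} {p ps} → p ∈ ps → x ∈ₛ p → x ∈ₛ ⋃ ps
∈-⋃⁺ (here refl) x∈p = x∈p∪q⁺ (inj₁ x∈p)
∈-⋃⁺ (there p∈)  x∈p = x∈p∪q⁺ (inj₂ (∈-⋃⁺ p∈ x∈p))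

∈-image⁻ : ∀ {r} (f : Fin r → Fin n) {y} → y ∈ₛ image f → ∃ λ i → y ≡ f i
∈-image⁻ {r = r} f y∈ with ∈-⋃⁻ (map (λ i → ⁅ f i ⁆) (allFin r)) y∈
... | p , p∈ , y∈p with ∈-map⁻ (λ i → ⁅ f i ⁆) p∈
...   | i , _ , refl = i , x∈⁅y⁆⇒x≡y (f i) y∈p

∈-image⁺ : ∀ {r} (f : Fin r → Fin n) i → f i ∈ₛ image f
∈-image⁺ f i = ∈-⋃⁺ (∈-map⁺ (λ i → ⁅ f i ⁆) (∈-allFin i)) (x∈⁅x⁆ (f i))

image-⊆⊇ : ∀ {r} (f : Fin r → Fin n) {E} → (∀ i → f i ∈ₛ E) → (∀ {y} → y ∈ₛ E → ∃ λ i → y ≡ f i) →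
  image f ≡ E
image-⊆⊇ f {E} f∈E E⊆f = ⊆-antisym
  (λ y∈ → let i , eq = ∈-image⁻ f y∈ in subst (_∈ₛ E) (sym eq) (f∈E i))
  (λ y∈ → let i , eq = E⊆f y∈ in subst (_∈ₛ image f) (sym eq) (∈-image⁺ f i))

∣p-x∣ : ∀ (p : Subset n) {x} → x ∈ₛ p → suc ∣ p - x ∣ ≡ ∣ p ∣
∣p-x∣ (inside ∷ p)  Vec.here       = cong (suc ∘ ∣_∣) (p─⊥≡p p)
∣p-x∣ (inside ∷ p)  (Vec.there x∈) = cong suc (∣p-x∣ p x∈)
∣p-x∣ (outside ∷ p) (Vec.there x∈) = ∣p-x∣ p x∈

x∉p-x : ∀ (p : Subset n) x → x ∉ₛ p - x
x∉p-x (_ ∷ p) zero    ()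
x∉p-x (_ ∷ p) (suc x) (Vec.there x∈) = x∉p-x p x x∈

∑-∈? : ∀ (p : Subset n) → ∑ (allFin n) (λ x → 𝟙 (x ∈? p)) ≡ ∣ p ∣
∑-∈? []            = refl
∑-∈? (inside ∷ p)  = cong suc (trans (∑-tabulate Fin.suc (λ x → 𝟙 (x ∈? (inside ∷ p)))) (∑-∈? p))
∑-∈? (outside ∷ p) = trans (∑-tabulate Fin.suc (λ x → 𝟙 (x ∈? (outside ∷ p)))) (∑-∈? p)

-- Indicator of the orderings of E, when j = ∣ E ∣.
ordering : Subset n → Vec (Fin n) j → ℕ
ordering E []      = 1
ordering E (a ∷ w) = 𝟙 (a ∈? E) * ordering (E - a) w

ordering≤1 : ∀ (E : Subset n) (x : Vec (Fin n) j) → ordering E x ≤ 1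
ordering≤1 E []      = ≤-refl
ordering≤1 E (a ∷ w) = *-≤1 (𝟙≤1 (a ∈? E)) (ordering≤1 (E - a) w)

∑-ordering : ∀ j (E : Subset n) → ∣ E ∣ ≡ j → ∑ (tuples n j) (ordering E) ≡ j !
∑-ordering zero E ∣E∣≡j = refl
∑-ordering {n} (suc j) E ∣E∣≡j = begin
  ∑ (tuples n (suc j)) (ordering E)
    ≡⟨ ∑-tuples-suc n j _ ⟩
  ∑ (allFin n) (λ a → ∑ (tuples n j) (λ w → 𝟙 (a ∈? E) * ordering (E - a) w))
    ≡⟨ ∑-cong (allFin n) (λ a → ∑-*ˡ (𝟙 (a ∈? E)) (tuples n j) _) ⟩
  ∑ (allFin n) (λ a → 𝟙 (a ∈? E) * ∑ (tuples n j) (ordering (E - a)))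
    ≡⟨ ∑-cong (allFin n) step ⟩
  ∑ (allFin n) (λ a → 𝟙 (a ∈? E) * j !)
    ≡⟨ ∑-*ʳ (j !) (allFin n) _ ⟩
  ∑ (allFin n) (λ a → 𝟙 (a ∈? E)) * j !
    ≡⟨ cong (_* j !) (trans (∑-∈? E) ∣E∣≡j) ⟩
  suc j ! ∎
  where
  open ≡-Reasoning
  step : ∀ a → 𝟙 (a ∈? E) * ∑ (tuples n j) (ordering (E - a)) ≡ 𝟙 (a ∈? E) * j !
  step a with a ∈? E
  ... | no _    = refl
  ... | yes a∈E = cong (1 *_) (∑-ordering j (E - a) (suc-injective (trans (∣p-x∣ E a∈E) ∣E∣≡j)))

ordering⇒∈ : ∀ (E : Subset n) (x : Vec (Fin n) j) → 0 < ordering E x → ∀ i → lookup x i ∈ₛ E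
ordering⇒∈ E (a ∷ w) p zero    = 𝟙⁻ (a ∈? E) (0<m*n⇒0<m (𝟙 (a ∈? E)) p)
ordering⇒∈ E (a ∷ w) p (suc i) =
  p─q⊆p E ⁅ a ⁆ (ordering⇒∈ (E - a) w (0<m*n⇒0<n (𝟙 (a ∈? E)) p) i)

ordering⇒injective : ∀ (E : Subset n) (x : Vec (Fin n) j) → 0 < ordering E x →
  ∀ i k → lookup x i ≡ lookup x k → i ≡ k
ordering⇒injective E (a ∷ w) p = inj
  where
  q = 0<m*n⇒0<n (𝟙 (a ∈? E)) p
  a∉w : ∀ i → a ≢ lookup w i
  a∉w i eq = x∉p-x E a (subst (_∈ₛ E - a) (sym eq) (ordering⇒∈ (E - a) w q i))
  inj : ∀ i k → lookup (a ∷ w) i ≡ lookup (a ∷ w) k → i ≡ k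
  inj zero    zero    _  = refl
  inj zero    (suc k) eq = contradiction eq (a∉w k)
  inj (suc i) zero    eq = contradiction (sym eq) (a∉w i)
  inj (suc i) (suc k) eq = cong suc (ordering⇒injective (E - a) w q i k eq)

∣p∣≡0⇒∉ : ∀ (p : Subset n) {x} → ∣ p ∣ ≡ 0 → x ∉ₛ p
∣p∣≡0⇒∉ p eq x∈ = contradiction (trans (∣p-x∣ p x∈) eq) λ ()

ordering⇒surjective : ∀ (E : Subset n) (x : Vec (Fin n) j) → ∣ E ∣ ≡ j → 0 < ordering E x →
  ∀ {y} → y ∈ₛ E → ∃ λ i → y ≡ lookup x i
ordering⇒surjective E []      eq p y∈ = contradiction y∈ (∣p∣≡0⇒∉ E eq)
ordering⇒surjective E (a ∷ w) eq p {y} y∈ with y Fin.≟ a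
... | yes y≡a = zero , y≡a
... | no  y≢a with ordering⇒surjective (E - a) w
        (suc-injective (trans (∣p-x∣ E (𝟙⁻ (a ∈? E) (0<m*n⇒0<m (𝟙 (a ∈? E)) p))) eq))
        (0<m*n⇒0<n (𝟙 (a ∈? E)) p)
        (x∈p∧x∉q⇒x∈p─q y∈ (y≢a ∘ x∈⁅y⁆⇒x≡y a))
...   | i , y≡ = suc i , y≡

ordering⇒image : ∀ (E : Subset n) (x : Vec (Fin n) j) → ∣ E ∣ ≡ j → 0 < ordering E x →
  image (lookup x) ≡ E
ordering⇒image E x eq p = image-⊆⊇ (lookup x) (ordering⇒∈ E x p) (ordering⇒surjective E x eq p)

module _ {r} (G : RGraph r n) where

  isEdge : Vec (Fin n) r → ℕ
  isEdge x = ∑ (edges G) (λ E → ordering E x)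

  ∑-isEdge : ∑ (tuples n r) isEdge ≡ edgeCount G * r !
  ∑-isEdge = trans (∑-swap (tuples n r) (edges G) _)
    (∑-All-const (All.map (λ {E} → ∑-ordering r E) (uniform G)))

  -- An ordering recovers its edge as an `image`, and `edges` has no repetitions, so a tuple is
  -- counted for at most one edge.
  isEdge≤1 : ∀ x → isEdge x ≤ 1
  isEdge≤1 x = ∑-unique≤1 (simple G) (λ E → ordering≤1 E x) λ {E} {E′} E∈ E′∈ p p′ →
    trans (sym (ordering⇒image E x (All.lookup (uniform G) E∈) p))
          (ordering⇒image E′ x (All.lookup (uniform G) E′∈) p′)

  isEdge⇒∈ : ∀ x → 0 < isEdge x → image (lookup x) ∈ edges G
  isEdge⇒∈ x p with ∑-pos (edges G) p
  ... | E , E∈ , q = subst (_∈ edges G) (sym (ordering⇒image E x (All.lookup (uniform G) E∈) q)) E∈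

  isEdge⇒injective : ∀ x → 0 < isEdge x → ∀ i k → lookup x i ≡ lookup x k → i ≡ k
  isEdge⇒injective x p with ∑-pos (edges G) p
  ... | E , _ , q = ordering⇒injective E x q

  edgeCount*r!≤n^r : edgeCount G * r ! ≤ n ^ r
  edgeCount*r!≤n^r = begin
    edgeCount G * r !           ≡⟨ ∑-isEdge ⟨
    ∑ (tuples n r) isEdge       ≤⟨ ∑-mono (tuples n r) isEdge≤1 ⟩
    ∑ (tuples n r) (λ _ → 1)    ≡⟨ trans (∑-tuples-const n r 1) (*-identityʳ _) ⟩
    n ^ r                       ∎
    where open ≤-Reasoning

-- Method of conditional expectations: the values f v are fixed one at a time, each so that
-- the weighted sum does not drop below its average over the r choices.
choose-average : ∀ {r} {X : Set} (xs : List X) (w : X → ℕ) {n} (g : Fin n → X → Fin (suc r) → ℕ) →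
  (∀ v x → 0 < w x → suc r ≤ ∑ (allFin (suc r)) (g v x)) →
  ∃ λ (f : Fin n → Fin (suc r)) → ∑ xs w ≤ ∑ xs (λ x → w x * ∏ (λ v → g v x (f v)))
choose-average xs w {zero} g avg = (λ ()) , ∑-mono xs (λ x → ≤-reflexive (sym (*-identityʳ (w x))))
choose-average {r} xs w {suc n} g avg =
  let c , w≤w′ = ∑-allFin-pigeonhole (suc r) {c = ∑ xs w} (s≤s z≤n) total
      w′       = λ x → w x * g zero x c
      f , w′≤  = choose-average xs w′ (g ∘ suc)
                   (λ v x p → avg (suc v) x (0<m*n⇒0<m (w x) p))
  in (λ { zero → c ; (suc v) → f v })
   , ≤-trans w≤w′ (≤-trans w′≤ (≤-reflexive (∑-cong xs λ x → *-assoc (w x) (g zero x c) _)))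
  where
  open ≤-Reasoning
  weight : ∀ x → suc r * w x ≤ w x * ∑ (allFin (suc r)) (g zero x)
  weight x with w x in eq
  ... | zero  = ≤-reflexive (*-zeroʳ (suc r))
  ... | suc m = ≤-trans (≤-reflexive (*-comm (suc r) (suc m)))
                  (*-monoʳ-≤ (suc m) (avg zero x (subst (0 <_) (sym eq) (s≤s z≤n))))
  total : suc r * ∑ xs w ≤ ∑ (allFin (suc r)) (λ c → ∑ xs (λ x → w x * g zero x c))
  total = begin
    suc r * ∑ xs w                                              ≡⟨ ∑-*ˡ (suc r) xs w ⟨
    ∑ xs (λ x → suc r * w x)                                    ≤⟨ ∑-mono xs weight ⟩
    ∑ xs (λ x → w x * ∑ (allFin (suc r)) (g zero x))            ≡⟨ ∑-cong xs (λ x → ∑-*ˡ (w x) (allFin (suc r)) _) ⟨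
    ∑ xs (λ x → ∑ (allFin (suc r)) (λ c → w x * g zero x c))    ≡⟨ ∑-swap xs (allFin (suc r)) _ ⟩
    ∑ (allFin (suc r)) (λ c → ∑ xs (λ x → w x * g zero x c))    ∎

module _ {n j : ℕ} where
  private r′ = suc j

  rainbow? : ∀ (f : Fin n → Fin r′) (x : Vec (Fin n) r′) → Dec (∀ i → f (lookup x i) ≡ i)
  rainbow? f x = Fin.all? (λ i → f (lookup x i) Fin.≟ i)

  -- Under a uniformly random colouring an injective tuple is rainbow with probability r^(-r);
  -- `choose-average` derandomises this. The weight `g v x c` is the factor that colour `c` of
  -- vertex `v` contributes, normalised to have mean 1 over `c`.
  rainbow-colouring : ∀ (F : Vec (Fin n) r′ → ℕ) →
    (∀ x → 0 < F x → ∀ i k → lookup x i ≡ lookup x k → i ≡ k) →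
    ∃ λ (f : Fin n → Fin r′) →
      ∑ (tuples n r′) F ≤ r′ ^ r′ * ∑ (tuples n r′) (λ x → F x * 𝟙 (rainbow? f x))
  rainbow-colouring F inj =
    let f , F≤ = choose-average (tuples n r′) F g avg
    in f , ≤-trans F≤ (≤-trans (∑-mono (tuples n r′) (bound f))
                               (≤-reflexive (∑-*ˡ (r′ ^ r′) (tuples n r′) _)))
    where
    -- The factor of `v` is spread over the positions so that the products over vertices and
    -- positions can be exchanged: at a fixed position `i`, every vertex other than `lookup x i` has
    -- factor 1.
    h : Vec (Fin n) r′ → Fin n → Fin r′ → Fin r′ → ℕ
    h x v c i with lookup x i Fin.≟ v
    ... | yes _ = r′ * 𝟙 (c Fin.≟ i)
    ... | no  _ = 1

    g : Fin n → Vec (Fin n) r′ → Fin r′ → ℕ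
    g v x c = ∏ (h x v c)

    h-off : ∀ x v c i → lookup x i ≢ v → h x v c i ≡ 1
    h-off x v c i xᵢ≢v with lookup x i Fin.≟ v
    ... | yes xᵢ≡v = contradiction xᵢ≡v xᵢ≢v
    ... | no  _    = refl

    h-on : ∀ x i c → h x (lookup x i) c i ≡ r′ * 𝟙 (c Fin.≟ i)
    h-on x i c with lookup x i Fin.≟ lookup x i
    ... | yes _  = refl
    ... | no neq = contradiction refl neq

    h-diag : ∀ x i → h x (lookup x i) i i ≡ r′
    h-diag x i = trans (h-on x i i) (trans (cong (r′ *_) 𝟙≡1) (*-identityʳ r′))
      where
      𝟙≡1 : 𝟙 (i Fin.≟ i) ≡ 1
      𝟙≡1 = ≤-antisym (𝟙≤1 (i Fin.≟ i)) (𝟙⁺ (i Fin.≟ i) refl)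

    avg : ∀ v x → 0 < F x → r′ ≤ ∑ (allFin r′) (g v x)
    avg v x p with Fin.any? (λ i → lookup x i Fin.≟ v)
    ... | no ∄i = ≤-reflexive (begin
      r′                          ≡⟨ *-identityʳ r′ ⟨
      r′ * 1                      ≡⟨ cong (_* 1) (length-allFin r′) ⟨
      length (allFin r′) * 1      ≡⟨ ∑-const (allFin r′) 1 ⟨
      ∑ (allFin r′) (λ _ → 1)     ≡⟨ ∑-cong (allFin r′) (λ c → sym (g≡1 c)) ⟩
      ∑ (allFin r′) (g v x)       ∎)
      where
      open ≡-Reasoning
      g≡1 : ∀ c → g v x c ≡ 1
      g≡1 c = ≤-antisym
        (≤-trans (∏-≤^ (λ i → ≤-reflexive (h-off x v c i (λ eq → ∄i (i , eq))))) (≤-reflexive (^-zeroˡ r′)))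
        (∏-pos (λ i → ≤-reflexive (sym (h-off x v c i (λ eq → ∄i (i , eq))))))
    -- The colour `i` alone contributes enough. Injectivity of `x` makes the other factors equal to
    -- 1: no second position asks the same vertex for another colour.
    ... | yes (i , refl) = begin
      r′                       ≡⟨ h-diag x i ⟨
      h x v i i                ≤⟨ ∏-∈ h>0 i ⟩
      g v x i                  ≤⟨ ∑-∈ (g v x) (∈-allFin i) ⟩
      ∑ (allFin r′) (g v x)    ∎
      where
      open ≤-Reasoning
      h>0 : ∀ l → 0 < h x v i l
      h>0 l with l Fin.≟ i
      ... | yes refl = subst (0 <_) (sym (h-diag x i)) (s≤s z≤n)
      ... | no l≢i   = ≤-reflexive (sym (h-off x v i l (l≢i ∘ inj x p l i)))

    ∏g≤ : ∀ f x → ∏ (λ v → g v x (f v)) ≤ ∏ (λ i → r′ * 𝟙 (f (lookup x i) Fin.≟ i))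
    ∏g≤ f x = begin
      ∏ (λ v → ∏ (λ i → h x v (f v) i))             ≡⟨ ∏-swap (λ v i → h x v (f v) i) ⟩
      ∏ (λ i → ∏ (λ v → h x v (f v) i))             ≤⟨ ∏-mono (λ i → ≤-trans
                                                          (∏-single (lookup x i) (λ v v≢ →
                                                             ≤-reflexive (h-off x v (f v) i (v≢ ∘ sym))))
                                                          (≤-reflexive (h-on x i _))) ⟩
      ∏ (λ i → r′ * 𝟙 (f (lookup x i) Fin.≟ i))     ∎
      where open ≤-Reasoning

    ∏≤rainbow : ∀ f x (d : Dec (∀ i → f (lookup x i) ≡ i)) →
      ∏ (λ i → r′ * 𝟙 (f (lookup x i) Fin.≟ i)) ≤ r′ ^ r′ * 𝟙 d
    ∏≤rainbow f x (yes _) = ≤-trans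
      (∏-≤^ (λ i → ≤-trans (*-monoʳ-≤ r′ (𝟙≤1 (f (lookup x i) Fin.≟ i))) (≤-reflexive (*-identityʳ r′))))
      (≤-reflexive (sym (*-identityʳ (r′ ^ r′))))
    ∏≤rainbow f x (no ¬p) = ≮⇒≥ λ q → ¬p λ i →
      𝟙⁻ (f (lookup x i) Fin.≟ i)
        (0<m*n⇒0<n r′ (∏-pos⁻ {u = λ i → r′ * 𝟙 (f (lookup x i) Fin.≟ i)} (≤-trans (s≤s z≤n) q) i))

    bound : ∀ f x → F x * ∏ (λ v → g v x (f v)) ≤ r′ ^ r′ * (F x * 𝟙 (rainbow? f x))
    bound f x = ≤-trans (*-monoʳ-≤ (F x) (≤-trans (∏g≤ f x) (∏≤rainbow f x (rainbow? f x))))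
      (≤-reflexive (*-swapˡ (F x) (r′ ^ r′) _))

-- A class of low degree

^-cancelʳ-< : ∀ r {m n} → m ^ r < n ^ r → m < n
^-cancelʳ-< r p = ≰⇒> λ n≤m → <⇒≱ p (^-monoˡ-≤ r n≤m)

^-cancelʳ-≤ : ∀ r {m n} → m ^ suc r ≤ n ^ suc r → m ≤ n
^-cancelʳ-≤ r p = ≮⇒≥ λ n<m → <⇒≱ (^-monoˡ-< (suc r) n<m) p

^-distribʳ-* : ∀ r m n → (m * n) ^ r ≡ m ^ r * n ^ r
^-distribʳ-* zero    m n = refl
^-distribʳ-* (suc r) m n = trans (cong (m * n *_) (^-distribʳ-* r m n)) (*-interchange m n _ _)

^-swap : ∀ m a b → (m ^ a) ^ b ≡ (m ^ b) ^ a
^-swap m a b = trans (^-*-assoc m a b) (trans (cong (m ^_) (*-comm a b)) (sym (^-*-assoc m b a)))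

-- Raising `m` by one raises its integer root by at most one.
root : ∀ r m → ∃ λ d → d ^ suc r ≤ m × m < suc d ^ suc r
root r zero    = 0 , z≤n , ≤-reflexive (sym (^-zeroˡ (suc r)))
root r (suc m) with root r m
... | d , d^r≤m , m<d′^r with suc d ^ suc r ≤? suc m
...   | yes p = suc d , p , ≤-<-trans m<d′^r (^-monoˡ-< (suc r) (n<1+n (suc d)))
...   | no ¬p = d , m≤n⇒m≤1+n d^r≤m , ≰⇒> ¬p

module _ {n j : ℕ} where
  private r = suc j

  degree : (Vec (Fin n) r → ℕ) → Fin r → Fin n → ℕ
  degree F i y = ∑ (tuples n r) (λ x → F x * 𝟙 (lookup x i Fin.≟ y))

  ∑-degree : ∀ F i → ∑ (allFin n) (degree F i) ≤ ∑ (tuples n r) F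
  ∑-degree F i = begin
    ∑ (allFin n) (degree F i)
      ≡⟨ ∑-swap (allFin n) (tuples n r) _ ⟩
    ∑ (tuples n r) (λ x → ∑ (allFin n) (λ y → F x * 𝟙 (lookup x i Fin.≟ y)))
      ≡⟨ ∑-cong (tuples n r) (λ x → ∑-*ˡ (F x) (allFin n) _) ⟩
    ∑ (tuples n r) (λ x → F x * ∑ (allFin n) (λ y → 𝟙 (lookup x i Fin.≟ y)))
      ≤⟨ ∑-mono (tuples n r) (λ x → *-monoʳ-≤ (F x) (one x)) ⟩
    ∑ (tuples n r) (λ x → F x * 1)
      ≡⟨ ∑-cong (tuples n r) (λ x → *-identityʳ (F x)) ⟩
    ∑ (tuples n r) F ∎
    where
    open ≤-Reasoning
    one : ∀ x → ∑ (allFin n) (λ y → 𝟙 (lookup x i Fin.≟ y)) ≤ 1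
    one x = ≤-trans (∑-mono (allFin n) (λ y → ≤1-bound (𝟙≤1 (lookup x i Fin.≟ y))
                      (λ p → 𝟙⁺ (y Fin.≟ lookup x i) (sym (𝟙⁻ (lookup x i Fin.≟ y) p)))))
                    (∑-≟ (lookup x i))

  degree≤n^j : ∀ {F} → (∀ x → F x ≤ 1) → ∀ i y → degree F i y ≤ n ^ j
  degree≤n^j {F} F≤1 i y = ∑-fibre _ (λ _ _ → 1) i y
    (λ x → *-≤1 (F≤1 x) (𝟙≤1 (lookup x i Fin.≟ y)))
    (λ x p → 𝟙⁻ (lookup x i Fin.≟ y) (0<m*n⇒0<n (F x) p) , λ _ _ → s≤s z≤n)
    (λ _ _ → ≤-reflexive (trans (∑-const (allFin n) 1) (trans (*-identityʳ _) (length-allFin n))))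

  -- With m the number of tuples and D the integer part of m^(j/r), at most D tuples through a
  -- vertex have only vertices of degree > D. Hence charging each tuple to a vertex of degree ≤ D
  -- when it has one, and to any of its vertices otherwise, charges at most D tuples to each vertex.
  low-degree-class : ∀ (F : Vec (Fin n) r → ℕ) → (∀ x → F x ≤ 1) →
    ∃ λ i → ∃ λ P → ∃ λ D →
      (∀ x → P x ≤ F x) × ∑ (tuples n r) F ≤ r * ∑ (tuples n r) P ×
      (∀ y → degree P i y ≤ D) × D ^ r ≤ ∑ (tuples n r) F ^ j
  low-degree-class F F≤1 =
    let i , m≤rP = ∑-allFin-pigeonhole r (s≤s z≤n) total
    in i , P i , D , P≤F i
     , ≤-trans m≤rP (≤-reflexive (∑-*ˡ r (tuples n r) (P i))) , degree≤D i , D^r≤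
    where
    m = ∑ (tuples n r) F
    D = proj₁ (root j (m ^ j))
    D^r≤ = proj₁ (proj₂ (root j (m ^ j)))
    <D′^r = proj₂ (proj₂ (root j (m ^ j)))
    H = proj₁ (root j m)
    H^r≤ = proj₁ (proj₂ (root j m))
    <H′^r = proj₂ (proj₂ (root j m))

    heavy? : ∀ i y → Dec (D < degree F i y)
    heavy? i y = D <? degree F i y

    -- The classes `P i` cover `F` but may overlap: a tuple lies in `P i` for each of its light
    -- positions, and in all of them if every vertex is heavy. Covering is all that the pigeonhole
    -- step asks for.
    low? : ∀ i x → Dec (degree F i (lookup x i) ≤ D ⊎ (∀ l → D < degree F l (lookup x l)))
    low? i x = (degree F i (lookup x i) ≤? D) ⊎-dec Fin.all? (λ l → heavy? l (lookup x l))

    P : Fin r → Vec (Fin n) r → ℕ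
    P i x = F x * 𝟙 (low? i x)

    P≤F : ∀ i x → P i x ≤ F x
    P≤F i x = ≤-trans (*-monoʳ-≤ (F x) (𝟙≤1 (low? i x))) (≤-reflexive (*-identityʳ (F x)))

    some-low : ∀ x → ∃ λ i → 0 < 𝟙 (low? i x)
    some-low x with Fin.any? (λ i → degree F i (lookup x i) ≤? D)
    ... | yes (i , p) = i , 𝟙⁺ (low? i x) (inj₁ p)
    ... | no ¬p = zero , 𝟙⁺ (low? zero x) (inj₂ λ l → ≰⇒> λ q → ¬p (l , q))

    total : r * m ≤ ∑ (allFin r) (λ i → ∑ (tuples n r) (λ x → r * P i x))
    total = begin
      r * m
        ≡⟨ ∑-*ˡ r (tuples n r) F ⟨
      ∑ (tuples n r) (λ x → r * F x)
        ≤⟨ ∑-mono (tuples n r) (λ x → *-monoʳ-≤ r (covered x)) ⟩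
      ∑ (tuples n r) (λ x → r * ∑ (allFin r) (λ i → P i x))
        ≡⟨ ∑-cong (tuples n r) (λ x → ∑-*ˡ r (allFin r) (λ i → P i x)) ⟨
      ∑ (tuples n r) (λ x → ∑ (allFin r) (λ i → r * P i x))
        ≡⟨ ∑-swap (tuples n r) (allFin r) _ ⟩
      ∑ (allFin r) (λ i → ∑ (tuples n r) (λ x → r * P i x)) ∎
      where
      open ≤-Reasoning
      covered : ∀ x → F x ≤ ∑ (allFin r) (λ i → P i x)
      covered x with some-low x
      ... | i , p = begin
        F x                             ≡⟨ *-identityʳ (F x) ⟨
        F x * 1                         ≤⟨ *-monoʳ-≤ (F x) p ⟩
        P i x                           ≤⟨ ∑-∈ (λ i → P i x) (∈-allFin i) ⟩
        ∑ (allFin r) (λ i → P i x)      ∎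

    heavy-count : Fin r → ℕ
    heavy-count i = ∑ (allFin n) (λ y → 𝟙 (heavy? i y))

    heavy-count-bound : ∀ i → heavy-count i * suc D ≤ m
    heavy-count-bound i = begin
      heavy-count i * suc D                           ≡⟨ ∑-*ʳ (suc D) (allFin n) _ ⟨
      ∑ (allFin n) (λ y → 𝟙 (heavy? i y) * suc D)     ≤⟨ ∑-mono (allFin n) (λ y → le y (heavy? i y)) ⟩
      ∑ (allFin n) (degree F i)                       ≤⟨ ∑-degree F i ⟩
      m                                               ∎
      where
      open ≤-Reasoning
      le : ∀ y (d : Dec (D < degree F i y)) → 𝟙 d * suc D ≤ degree F i y
      le y (yes p) = ≤-trans (≤-reflexive (*-identityˡ (suc D))) p
      le y (no _)  = z≤n

    -- Otherwise H + 1 heavy vertices of degree at least D + 1 would give (H+1)(D+1) ≤ m, whereas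
    -- (H+1)^r > m and (D+1)^r > m^j multiply to more than m^r.
    heavy-count≤H : ∀ i → heavy-count i ≤ H
    heavy-count≤H i = ≮⇒≥ λ H<h → n≮n (m * m ^ j) (begin-strict
      m * m ^ j                         <⟨ *-mono-< <H′^r <D′^r ⟩
      suc H ^ r * suc D ^ r             ≤⟨ *-monoˡ-≤ (suc D ^ r) (^-monoˡ-≤ r H<h) ⟩
      heavy-count i ^ r * suc D ^ r     ≡⟨ ^-distribʳ-* r (heavy-count i) (suc D) ⟨
      (heavy-count i * suc D) ^ r       ≤⟨ ^-monoˡ-≤ r (heavy-count-bound i) ⟩
      m * m ^ j                         ∎)
      where open ≤-Reasoning

    H^j≤D : H ^ j ≤ D
    H^j≤D = s≤s⁻¹ (^-cancelʳ-< r (begin-strict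
      (H ^ j) ^ r     ≡⟨ ^-swap H j r ⟩
      (H ^ r) ^ j     ≤⟨ ^-monoˡ-≤ j H^r≤ ⟩
      m ^ j           <⟨ <D′^r ⟩
      suc D ^ r       ∎))
      where open ≤-Reasoning

    degree≤D : ∀ i y → degree (P i) i y ≤ D
    degree≤D i y with degree F i y ≤? D
    ... | yes p = ≤-trans (∑-mono (tuples n r) (λ x → *-monoˡ-≤ (𝟙 (lookup x i Fin.≟ y)) (P≤F i x))) p
    -- For a heavy `y`, all vertices of each tuple counted are heavy, so every other coordinate has
    -- at most `H` values, and `H ^ j` fits under `D`.
    ... | no ¬p = ≤-trans (∑-fibre _ (λ l a → 𝟙 (heavy? l a)) i y
        (λ x → *-≤1 (≤-trans (P≤F i x) (F≤1 x)) (𝟙≤1 (lookup x i Fin.≟ y)))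
        through (λ l _ → heavy-count≤H l)) H^j≤D
      where
      through : ∀ x → 0 < P i x * 𝟙 (lookup x i Fin.≟ y) →
        lookup x i ≡ y × (∀ l → l ≢ i → 0 < 𝟙 (heavy? l (lookup x l)))
      through x p with 𝟙⁻ (lookup x i Fin.≟ y) (0<m*n⇒0<n (P i x) p)
      ... | refl with 𝟙⁻ (low? i x) (0<m*n⇒0<n (F x) (0<m*n⇒0<m (P i x) p))
      ...   | inj₁ q = contradiction q ¬p
      ...   | inj₂ q = refl , λ l _ → 𝟙⁺ (heavy? l (lookup x l)) (q l)

-- Finding partite subgraphs

-- A greedy substitute for the convexity step of Kővári-Sós-Turán. Averaging yields a vertex whose
-- neighbourhood carries at least a share 1/Q of the weight `L`; restricting `L` to it and repeating
-- costs `Q ^ m` in all. Each chosen vertex is deleted from the relation to keep the choices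
-- distinct. This lowers a degree by at most 1, and the slack `m * Q` pays for it.
pick : ∀ {X : Set} (xs : List X) {n} Q m (P : Fin n → X → ℕ) (L : X → ℕ) → 0 < n →
  (∀ a x → P a x ≤ 1) →
  (∀ x → 0 < L x → n + m * Q ≤ Q * ∑ (allFin n) (λ a → P a x)) →
  0 < ∑ xs L →
  ∃ λ (A : Fin m → Fin n) → ∃ λ (L′ : X → ℕ) →
    (∀ i k → A i ≡ A k → i ≡ k) ×
    (∀ x → L′ x ≤ L x) ×
    (∀ x → 0 < L′ x → ∀ i → 0 < P (A i) x) ×
    ∑ xs L ≤ Q ^ m * ∑ xs L′
pick xs Q zero P L 0<n P≤1 rich 0<L =
  (λ ()) , L , (λ ()) , (λ _ → ≤-refl) , (λ _ _ ()) , ≤-reflexive (sym (*-identityˡ _))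
pick xs {n} Q (suc m) P L 0<n P≤1 rich 0<L = extend (∑-allFin-pigeonhole n 0<n average)
  where
  average : n * ∑ xs L ≤ ∑ (allFin n) (λ a → Q * ∑ xs (λ x → L x * P a x))
  average = begin
    n * ∑ xs L
      ≡⟨ ∑-*ˡ n xs L ⟨
    ∑ xs (λ x → n * L x)
      ≤⟨ ∑-mono xs pointwise ⟩
    ∑ xs (λ x → ∑ (allFin n) (λ a → Q * (L x * P a x)))
      ≡⟨ ∑-swap xs (allFin n) _ ⟩
    ∑ (allFin n) (λ a → ∑ xs (λ x → Q * (L x * P a x)))
      ≡⟨ ∑-cong (allFin n) (λ a → ∑-*ˡ Q xs _) ⟩
    ∑ (allFin n) (λ a → Q * ∑ xs (λ x → L x * P a x))
      ∎
    where
    open ≤-Reasoning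
    pointwise : ∀ x → n * L x ≤ ∑ (allFin n) (λ a → Q * (L x * P a x))
    pointwise x with 0 <? L x
    ... | no ¬p = ≤-trans (≤-reflexive (trans (cong (n *_) (n≤0⇒n≡0 (≮⇒≥ ¬p))) (*-zeroʳ n))) z≤n
    ... | yes p = begin
      n * L x                                         ≤⟨ *-monoˡ-≤ (L x) (≤-trans (m≤m+n n _) (rich x p)) ⟩
      Q * ∑ (allFin n) (λ a → P a x) * L x            ≡⟨ *-assoc Q _ (L x) ⟩
      Q * (∑ (allFin n) (λ a → P a x) * L x)          ≡⟨ cong (Q *_) (*-comm _ (L x)) ⟩
      Q * (L x * ∑ (allFin n) (λ a → P a x))          ≡⟨ cong (Q *_) (∑-*ˡ (L x) (allFin n) _) ⟨
      Q * ∑ (allFin n) (λ a → L x * P a x)            ≡⟨ ∑-*ˡ Q (allFin n) _ ⟨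
      ∑ (allFin n) (λ a → Q * (L x * P a x))          ∎

  extend : ∃ (λ a → ∑ xs L ≤ Q * ∑ xs (λ x → L x * P a x)) → _
  extend (a , L≤) =
    let A , L′ , A-inj , L′≤L₁ , pos , L₁≤ = pick xs Q m P₁ L₁ 0<n P₁≤1 rich₁ 0<L₁
        x , _ , p = ∑-pos xs (0<m*n⇒0<n (Q ^ m) (≤-trans 0<L₁ L₁≤))
        -- Some weight survives at a point `x`, and there `P₁` vanishes on `a`.
        A≢a : ∀ i → A i ≢ a
        A≢a i eq = n≮0 (subst (0 <_) (cong (1 ∸_) (𝟙-yes (A i Fin.≟ a) eq))
          (0<m*n⇒0<n (P (A i) x) {1 ∸ 𝟙 (A i Fin.≟ a)} (pos x p i)))
    in (λ { zero → a ; (suc i) → A i })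
     , L′
     , (λ { zero    zero    _  → refl
          ; zero    (suc k) eq → contradiction (sym eq) (A≢a k)
          ; (suc i) zero    eq → contradiction eq (A≢a i)
          ; (suc i) (suc k) eq → cong suc (A-inj i k eq) })
     , (λ x → ≤-trans (L′≤L₁ x) (L₁≤L x))
     , (λ { x p zero    → 0<m*n⇒0<n (L x) (≤-trans p (L′≤L₁ x))
          ; x p (suc i) → 0<m*n⇒0<m (P (A i) x) (pos x p i) })
     , ≤-trans L≤ (≤-trans (*-monoʳ-≤ Q L₁≤) (≤-reflexive (sym (*-assoc Q (Q ^ m) _))))
    where
    L₁ = λ x → L x * P a x
    P₁ = λ b x → P b x * (1 ∸ 𝟙 (b Fin.≟ a))
    L₁≤L : ∀ x → L₁ x ≤ L x
    L₁≤L x = ≤-trans (*-monoʳ-≤ (L x) (P≤1 a x)) (≤-reflexive (*-identityʳ (L x)))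
    0<L₁ : 0 < ∑ xs L₁
    0<L₁ = 0<m*n⇒0<n Q (≤-trans 0<L L≤)
    P₁≤1 : ∀ b x → P₁ b x ≤ 1
    P₁≤1 b x = *-≤1 {P b x} (P≤1 b x) (m∸n≤m 1 (𝟙 (b Fin.≟ a)))
    deg≤ : ∀ x → ∑ (allFin n) (λ b → P b x) ≤ ∑ (allFin n) (λ b → P₁ b x) + 1
    deg≤ x = begin
      ∑ (allFin n) (λ b → P b x)
        ≤⟨ ∑-mono (allFin n) split ⟩
      ∑ (allFin n) (λ b → P₁ b x + 𝟙 (b Fin.≟ a))
        ≡⟨ ∑-+ (allFin n) _ _ ⟩
      ∑ (allFin n) (λ b → P₁ b x) + ∑ (allFin n) (λ b → 𝟙 (b Fin.≟ a))
        ≤⟨ +-monoʳ-≤ _ (∑-≟ a) ⟩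
      ∑ (allFin n) (λ b → P₁ b x) + 1 ∎
      where
      open ≤-Reasoning
      split : ∀ b → P b x ≤ P₁ b x + 𝟙 (b Fin.≟ a)
      split b with 𝟙 (b Fin.≟ a) | 𝟙≤1 (b Fin.≟ a)
      ... | zero  | _ = ≤-reflexive (sym (trans (+-identityʳ _) (*-identityʳ _)))
      ... | suc c | _ = ≤-trans (P≤1 b x) (≤-trans (s≤s z≤n) (m≤n+m (suc c) _))
    rich₁ : ∀ x → 0 < L₁ x → n + m * Q ≤ Q * ∑ (allFin n) (λ b → P₁ b x)
    rich₁ x p = +-cancelˡ-≤ Q _ _ (begin
      Q + (n + m * Q)                              ≡⟨ reorder Q n m ⟩
      n + suc m * Q                                ≤⟨ rich x (0<m*n⇒0<m (L x) p) ⟩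
      Q * ∑ (allFin n) (λ b → P b x)               ≤⟨ *-monoʳ-≤ Q (deg≤ x) ⟩
      Q * (∑ (allFin n) (λ b → P₁ b x) + 1)        ≡⟨ distrib Q _ ⟩
      Q + Q * ∑ (allFin n) (λ b → P₁ b x)          ∎)
      where
      open ≤-Reasoning
      reorder : ∀ Q n m → Q + (n + m * Q) ≡ n + suc m * Q
      reorder = solve-∀
      distrib : ∀ Q d → Q * (d + 1) ≡ Q + Q * d
      distrib = solve-∀

-- If a relation has density at least 3/(2Q), then the common link of some s vertices of its first
-- class has density at least 3/(2Q′) with Q′ = 5 Q ^ (s + 1).
tower : ℕ → ℕ → ℕ → ℕ
tower s zero    Q = Q
tower s (suc j) Q = tower s j (5 * Q ^ suc s)

m<2^m : ∀ m → m < 2 ^ m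
m<2^m zero    = s≤s z≤n
m<2^m (suc m) = begin-strict
  suc m            <⟨ s≤s (m<2^m m) ⟩
  1 + 2 ^ m        ≤⟨ +-monoˡ-≤ (2 ^ m) (≤-trans (s≤s z≤n) (m<2^m m)) ⟩
  2 ^ m + 2 ^ m    ≡⟨ cong (2 ^ m +_) (+-identityʳ (2 ^ m)) ⟨
  2 ^ suc m        ∎
  where open ≤-Reasoning

≤-next : ∀ s Q → 1 ≤ Q → Q ≤ 5 * Q ^ suc s
≤-next s Q@(suc _) _ = begin
  Q                ≡⟨ *-identityʳ Q ⟨
  Q * 1            ≤⟨ *-monoʳ-≤ Q (m^n>0 Q s) ⟩
  Q ^ suc s        ≤⟨ m≤m+n _ _ ⟩
  5 * Q ^ suc s    ∎
  where open ≤-Reasoning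

tower-≥ : ∀ s j {Q} → 1 ≤ Q → Q ≤ tower s j Q
tower-≥ s zero        1≤Q = ≤-refl
tower-≥ s (suc j) {Q} 1≤Q =
  ≤-trans (≤-next s Q 1≤Q) (tower-≥ s j (≤-trans 1≤Q (≤-next s Q 1≤Q)))

-- A poor point has degree below n/Q + s ≤ 7n/(6Q). An average degree of 3n/(2Q) therefore leaves
-- (3/2 - 7/6) n/Q = n/(3Q) per point to the `V` rich ones, each of degree at most n.
markov : ∀ M n Q V N s → 0 < n → 3 * (n * M) ≤ 2 * Q * N →
  Q * N ≤ Q * n * V + M * (n + s * Q) → 6 * s * Q ≤ n → M ≤ 3 * Q * V
markov M n@(suc _) Q V N s _ dense total 6sQ≤n = *-cancelˡ-≤ (2 * n) (+-cancelʳ-≤ (7 * n * M) _ _ (begin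
  2 * n * M + 7 * n * M                               ≡⟨ e₁ n M ⟩
  3 * (3 * (n * M))                                   ≤⟨ *-monoʳ-≤ 3 dense ⟩
  3 * (2 * Q * N)                                     ≡⟨ e₂ Q N ⟩
  6 * (Q * N)                                         ≤⟨ *-monoʳ-≤ 6 total ⟩
  6 * (Q * n * V + M * (n + s * Q))                   ≡⟨ e₃ Q n V M s ⟩
  2 * n * (3 * Q * V) + M * (6 * n + 6 * s * Q)       ≤⟨ +-monoʳ-≤ _ (*-monoʳ-≤ M (+-monoʳ-≤ (6 * n) 6sQ≤n)) ⟩
  2 * n * (3 * Q * V) + M * (6 * n + n)               ≡⟨ cong (2 * n * (3 * Q * V) +_) (e₄ M n) ⟩
  2 * n * (3 * Q * V) + 7 * n * M                     ∎))
  where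
  open ≤-Reasoning
  e₁ : ∀ n M → 2 * n * M + 7 * n * M ≡ 3 * (3 * (n * M))
  e₁ = solve-∀
  e₂ : ∀ Q d → 3 * (2 * Q * d) ≡ 6 * (Q * d)
  e₂ = solve-∀
  e₃ : ∀ Q n V M s → 6 * (Q * n * V + M * (n + s * Q)) ≡ 2 * n * (3 * Q * V) + M * (6 * n + 6 * s * Q)
  e₃ = solve-∀
  e₄ : ∀ M n → M * (6 * n + n) ≡ 7 * n * M
  e₄ = solve-∀

module _ {n s : ℕ} where

  -- A point is rich if its degree into the next class is at least n/Q plus the s + 1 that `pick`
  -- needs for distinctness. Rich points form a share of at least 1/(3Q), and `pick` keeps a share
  -- Q^(-(s+1)) of them. The link thus has density at least 3/(9 Q^(s+2)), and the 5 is 9/2 rounded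
  -- up.
  find-link : ∀ j Q (P : Vec (Fin n) (suc j) → Fin n → ℕ) → 2 ≤ Q → (∀ w a → P w a ≤ 1) →
    3 * n ^ suc (suc j) ≤ 2 * Q * ∑ (tuples n (suc j)) (λ w → ∑ (allFin n) (P w)) →
    5 * Q ^ suc (suc s) ≤ n →
    ∃ λ (A : Fin (suc s) → Fin n) → ∃ λ (L : Vec (Fin n) j → Fin n → ℕ) →
      (∀ b b′ → A b ≡ A b′ → b ≡ b′) × (∀ w a → L w a ≤ 1) ×
      (∀ w a → 0 < L w a → ∀ b → 0 < P (A b ∷ w) a) ×
      3 * n ^ suc j ≤ 2 * (5 * Q ^ suc (suc s)) * ∑ (tuples n j) (λ w → ∑ (allFin n) (L w))
  find-link j Q P 2≤Q P≤1 dense next≤n = finish (pick X Q (suc s) (λ a x → P (a ∷ proj₁ x) (proj₂ x)) W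
      0<n (λ a x → P≤1 _ _) (λ x p → 𝟙⁻ (rich? x) p) 0<W)
    where
    open ≤-Reasoning
    X = cartesianProduct (tuples n j) (allFin n)
    deg : Vec (Fin n) j × Fin n → ℕ
    deg (w , b) = ∑ (allFin n) (λ a → P (a ∷ w) b)
    rich? : ∀ x → Dec (n + suc s * Q ≤ Q * deg x)
    rich? x = n + suc s * Q ≤? Q * deg x
    W : Vec (Fin n) j × Fin n → ℕ
    W x = 𝟙 (rich? x)
    M = n ^ suc j
    1≤Q : 1 ≤ Q
    1≤Q = ≤-trans (s≤s z≤n) 2≤Q
    0<n : 0 < n
    0<n = ≤-trans 1≤Q (≤-trans (≤-next (suc s) Q 1≤Q) next≤n)
    6sQ≤n : 6 * suc s * Q ≤ n
    6sQ≤n = begin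
      6 * suc s * Q                ≤⟨ *-monoˡ-≤ Q (*-monoʳ-≤ 6 (m<2^m s)) ⟩
      6 * 2 ^ s * Q                ≡⟨ cong (_* Q) (*-assoc 3 2 (2 ^ s)) ⟩
      3 * 2 ^ suc s * Q            ≤⟨ *-monoˡ-≤ Q (*-mono-≤ {3} {5} (s≤s (s≤s (s≤s z≤n))) (^-monoˡ-≤ (suc s) 2≤Q)) ⟩
      5 * Q ^ suc s * Q            ≡⟨ trans (*-assoc 5 (Q ^ suc s) Q) (cong (5 *_) (*-comm (Q ^ suc s) Q)) ⟩
      5 * Q ^ suc (suc s)          ≤⟨ next≤n ⟩
      n                            ∎
    ∑X : ∀ F → ∑ X F ≡ ∑ (tuples n j) (λ w → ∑ (allFin n) (λ a → F (w , a)))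
    ∑X = ∑-cartesianProductWith _,_ (tuples n j) (allFin n)
    ∑deg : ∑ X deg ≡ ∑ (tuples n (suc j)) (λ w → ∑ (allFin n) (P w))
    ∑deg = begin-equality
      ∑ X deg
        ≡⟨ ∑-swap X (allFin n) _ ⟩
      ∑ (allFin n) (λ a → ∑ X (λ x → P (a ∷ proj₁ x) (proj₂ x)))
        ≡⟨ ∑-cong (allFin n) (λ a → ∑X _) ⟩
      ∑ (allFin n) (λ a → ∑ (tuples n j) (λ w → ∑ (allFin n) (P (a ∷ w))))
        ≡⟨ ∑-tuples-suc n j _ ⟨
      ∑ (tuples n (suc j)) (λ w → ∑ (allFin n) (P w)) ∎
    ∑X-const : ∀ c → ∑ X (λ _ → c) ≡ M * c
    ∑X-const c = begin-equality
      ∑ X (λ _ → c)                                       ≡⟨ ∑X _ ⟩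
      ∑ (tuples n j) (λ _ → ∑ (allFin n) (λ _ → c))       ≡⟨ ∑-tuples-const n j _ ⟩
      n ^ j * ∑ (allFin n) (λ _ → c)                      ≡⟨ cong (n ^ j *_) (trans (∑-const (allFin n) c) (cong (_* c) (length-allFin n))) ⟩
      n ^ j * (n * c)                                     ≡⟨ trans (sym (*-assoc (n ^ j) n c)) (cong (_* c) (*-comm (n ^ j) n)) ⟩
      M * c                                               ∎
    split : ∀ x → Q * deg x ≤ Q * n * W x + (n + suc s * Q)
    split x = go (rich? x)
      where
      deg≤n : deg x ≤ n
      deg≤n = begin
        deg x                       ≤⟨ ∑-mono (allFin n) (λ a → P≤1 _ _) ⟩
        ∑ (allFin n) (λ _ → 1)      ≡⟨ trans (∑-const (allFin n) 1) (trans (*-identityʳ _) (length-allFin n)) ⟩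
        n                           ∎
      go : ∀ (d : Dec (n + suc s * Q ≤ Q * deg x)) → Q * deg x ≤ Q * n * 𝟙 d + (n + suc s * Q)
      go (no ¬p) = ≤-trans (<⇒≤ (≰⇒> ¬p)) (m≤n+m _ (Q * n * 0))
      go (yes _) = ≤-trans (≤-trans (*-monoʳ-≤ Q deg≤n) (≤-reflexive (sym (*-identityʳ (Q * n))))) (m≤m+n _ _)
    total : Q * ∑ X deg ≤ Q * n * ∑ X W + M * (n + suc s * Q)
    total = begin
      Q * ∑ X deg                                               ≡⟨ ∑-*ˡ Q X deg ⟨
      ∑ X (λ x → Q * deg x)                                     ≤⟨ ∑-mono X split ⟩
      ∑ X (λ x → Q * n * W x + (n + suc s * Q))                 ≡⟨ ∑-+ X _ _ ⟩
      ∑ X (λ x → Q * n * W x) + ∑ X (λ _ → n + suc s * Q)       ≡⟨ cong₂ _+_ (∑-*ˡ (Q * n) X W) (∑X-const _) ⟩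
      Q * n * ∑ X W + M * (n + suc s * Q)                       ∎
    M≤3QW : M ≤ 3 * Q * ∑ X W
    M≤3QW = markov M n Q (∑ X W) (∑ X deg) (suc s) 0<n
      (subst (λ N → 3 * (n * M) ≤ 2 * Q * N) (sym ∑deg) dense) total 6sQ≤n
    0<W : 0 < ∑ X W
    0<W = 0<m*n⇒0<n (3 * Q) (≤-trans (m^n>0 n {{>-nonZero 0<n}} (suc j)) M≤3QW)
    dense′ : ∀ L → ∑ X W ≤ Q ^ suc s * ∑ X L →
      3 * n ^ suc j ≤ 2 * (5 * Q ^ suc (suc s)) * ∑ (tuples n j) (λ w → ∑ (allFin n) (λ a → L (w , a)))
    dense′ L W≤ = begin
      3 * M                                          ≤⟨ *-monoʳ-≤ 3 M≤3QW ⟩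
      3 * (3 * Q * ∑ X W)                            ≤⟨ ≤-trans (m≤m+n _ (Q * ∑ X W)) (≤-reflexive (e₁ Q _)) ⟩
      10 * Q * ∑ X W                                 ≤⟨ *-monoʳ-≤ (10 * Q) W≤ ⟩
      10 * Q * (Q ^ suc s * ∑ X L)                   ≡⟨ e₂ Q (Q ^ suc s) _ ⟩
      2 * (5 * (Q * Q ^ suc s)) * ∑ X L              ≡⟨ cong (2 * (5 * Q ^ suc (suc s)) *_) (∑X L) ⟩
      2 * (5 * Q ^ suc (suc s)) * ∑ (tuples n j) (λ w → ∑ (allFin n) (λ a → L (w , a))) ∎
      where
      e₁ : ∀ Q V → 3 * (3 * Q * V) + Q * V ≡ 10 * Q * V
      e₁ = solve-∀
      e₂ : ∀ Q q V → 10 * Q * (q * V) ≡ 2 * (5 * (Q * q)) * V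
      e₂ = solve-∀
    finish : _ → _
    finish (A , L , A-inj , L≤W , A⇒P , W≤L) =
      A , (λ w a → L (w , a)) , A-inj , (λ w a → ≤-trans (L≤W (w , a)) (𝟙≤1 (rich? (w , a))))
      , (λ w a → A⇒P (w , a)) , dense′ L W≤L

place : ∀ {n j} → Fin (suc j) → (Fin j → Fin n) → Fin n → Vec (Fin n) (suc j)
place i₀ u a = insertAt (Vec.tabulate u) i₀ a

lookup-place : ∀ {n j} (i₀ : Fin (suc j)) (u : Fin j → Fin n) a i → lookup (place i₀ u a) (punchIn i₀ i) ≡ u i
lookup-place i₀ u a i = trans (insertAt-punchIn (Vec.tabulate u) i₀ a i) (lookup∘tabulate u i)

lookup-place-i₀ : ∀ {n j} (i₀ : Fin (suc j)) (u : Fin j → Fin n) a → lookup (place i₀ u a) i₀ ≡ a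
lookup-place-i₀ i₀ u a = insertAt-lookup (Vec.tabulate u) i₀ a

∑-union : ∀ {A X : Set} (as : List A) (xs : List X) (F : X → ℕ) (h : A → X → ℕ) {c} →
  (∀ a → ∑ xs (λ x → F x * h a x) ≤ c) →
  ∑ xs (λ x → F x * ∑ as (λ a → h a x)) ≤ length as * c
∑-union as xs F h {c} h≤c = begin
  ∑ xs (λ x → F x * ∑ as (λ a → h a x))     ≡⟨ ∑-cong xs (λ x → ∑-*ˡ (F x) as _) ⟨
  ∑ xs (λ x → ∑ as (λ a → F x * h a x))     ≡⟨ ∑-swap xs as _ ⟩
  ∑ as (λ a → ∑ xs (λ x → F x * h a x))     ≤⟨ ∑-mono as h≤c ⟩
  ∑ as (λ _ → c)                            ≡⟨ ∑-const as c ⟩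
  length as * c                             ∎
  where open ≤-Reasoning

∑-union-Fin : ∀ {X : Set} m (xs : List X) (F : X → ℕ) (h : Fin m → X → ℕ) {c} →
  (∀ a → ∑ xs (λ x → F x * h a x) ≤ c) →
  ∑ xs (λ x → F x * ∑ (allFin m) (λ a → h a x)) ≤ m * c
∑-union-Fin m xs F h {c} h≤c =
  ≤-trans (∑-union (allFin m) xs F h h≤c) (≤-reflexive (cong (_* c) (length-allFin m)))

module _ {n s t : ℕ} where

  -- For the last class the neighbourhood of one point suffices, so `pick` runs over a single point
  -- and only the positivity of the surviving weight is used. The loss `Q ^ suc t` is harmless, and
  -- the size of this class may be a power of n.
  find-class : ∀ Q (P : Fin n → ℕ) → 2 ≤ Q → (∀ a → P a ≤ 1) →
    3 * n ^ 1 ≤ 2 * Q * (∑ (allFin n) P + 0) → 2 * suc t * Q ≤ n →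
    ∃ λ (T : Fin (suc t) → Fin n) → (∀ b b′ → T b ≡ T b′ → b ≡ b′) × (∀ b → 0 < P (T b))
  find-class Q P 2≤Q P≤1 dense large = finish (pick (tt ∷ []) Q (suc t) (λ a _ → P a) (λ _ → 1) 0<n
      (λ a _ → P≤1 a) (λ _ _ → rich) (s≤s z≤n))
    where
    finish : _ → _
    finish (T , L , T-inj , _ , pos , 1≤) =
      T , T-inj , pos tt (subst (0 <_) (+-identityʳ (L tt)) (0<m*n⇒0<n (Q ^ suc t) 1≤))
    0<n : 0 < n
    0<n = ≤-trans (*-pos {2 * suc t} {Q} (s≤s z≤n) (≤-trans (s≤s z≤n) 2≤Q)) large
    rich : n + suc t * Q ≤ Q * ∑ (allFin n) (P)
    rich = *-cancelˡ-≤ {n + suc t * Q} {Q * ∑ (allFin n) (P)} 2 (begin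
      2 * (n + suc t * Q)                          ≡⟨ e₁ n (suc t) Q ⟩
      2 * n + 2 * suc t * Q                        ≤⟨ +-monoʳ-≤ (2 * n) large ⟩
      2 * n + n                                    ≡⟨ e₂ n ⟩
      3 * n ^ 1                                    ≤⟨ dense ⟩
      2 * Q * (∑ (allFin n) (P) + 0)            ≡⟨ e₃ Q _ ⟩
      2 * (Q * ∑ (allFin n) (P))                ∎)
      where
      open ≤-Reasoning
      e₁ : ∀ n t Q → 2 * (n + t * Q) ≡ 2 * n + 2 * t * Q
      e₁ = solve-∀
      e₂ : ∀ n → 2 * n + n ≡ 3 * (n * 1)
      e₂ = solve-∀
      e₃ : ∀ Q d → 2 * Q * (d + 0) ≡ 2 * (Q * d)
      e₃ = solve-∀
  -- Each round fixes one class and passes to its common link. Injectivity is recorded within each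
  -- class only; different classes are separated later by their colours.
  find-partite : ∀ j Q (P : Vec (Fin n) j → Fin n → ℕ) → 2 ≤ Q → (∀ w a → P w a ≤ 1) →
    3 * n ^ suc j ≤ 2 * Q * ∑ (tuples n j) (λ w → ∑ (allFin n) (P w)) →
    2 * suc t * tower (suc s) j Q ≤ n →
    ∃ λ (S : Fin j → Fin (suc s) → Fin n) → ∃ λ (T : Fin (suc t) → Fin n) →
      (∀ i b b′ → S i b ≡ S i b′ → b ≡ b′) × (∀ b b′ → T b ≡ T b′ → b ≡ b′) ×
      (∀ (c : Fin j → Fin (suc s)) b → 0 < P (Vec.tabulate (λ i → S i (c i))) (T b))
  find-partite zero Q P 2≤Q P≤1 dense large = base (find-class Q (P []) 2≤Q (P≤1 []) dense large)
    where
    base : ∃ (λ T → (∀ b b′ → T b ≡ T b′ → b ≡ b′) × (∀ b → 0 < P [] (T b))) → _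
    base (T , T-inj , pos) = (λ ()) , T , (λ ()) , T-inj , λ _ → pos
  find-partite (suc j) Q P 2≤Q P≤1 dense large = outer (find-link j Q P 2≤Q P≤1 dense next≤n)
    where
    1≤Q : 1 ≤ Q
    1≤Q = ≤-trans (s≤s z≤n) 2≤Q
    next≤n : 5 * Q ^ suc (suc s) ≤ n
    next≤n = ≤-trans (tower-≥ (suc s) j (≤-trans 1≤Q (≤-next (suc s) Q 1≤Q)))
                     (≤-trans (m≤n*m (tower (suc s) (suc j) Q) (2 * suc t)) large)
    outer : _ → _
    outer (A , L , A-inj , L≤1 , A⇒P , dense′) =
      inner (find-partite j (5 * Q ^ suc (suc s)) L (≤-trans 2≤Q (≤-next (suc s) Q 1≤Q)) L≤1 dense′ large)
      where
      inner : _ → _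
      inner (S , T , S-inj , T-inj , pos) =
        (λ { zero → A ; (suc i) → S i }) , T
        , (λ { zero → A-inj ; (suc i) → S-inj i }) , T-inj
        , λ c b → A⇒P _ _ (pos (c ∘ suc) b) (c zero)

  -- Greedy search for disjoint copies

  module _ {j : ℕ} (i₀ : Fin (suc j)) (P : Vec (Fin n) (suc j) → ℕ) (P≤1 : ∀ x → P x ≤ 1)
           (D Q : ℕ) (degree≤D : ∀ y → degree P i₀ y ≤ D) (2≤Q : 2 ≤ Q)
           (large : 2 * suc t * tower (suc s) j Q ≤ n) where

    loss = j * (suc s * n ^ j) + suc t * D

    -- A copy hits at most `loss` tuples: `n ^ j` through each vertex outside class `i₀`, by the
    -- trivial degree bound, and `D` through each vertex in it. The hypothesis reserves this amount
    -- for `k` copies on top of the density 3/(2Q) that `find-partite` needs.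
    find-disjoint : ∀ k → 3 * n ^ suc j + 2 * Q * (k * loss) ≤ 2 * Q * ∑ (tuples n (suc j)) P →
      ∃ λ (S : Fin k → Fin j → Fin (suc s) → Fin n) → ∃ λ (T : Fin k → Fin (suc t) → Fin n) →
        (∀ i a a′ b b′ → S a i b ≡ S a′ i b′ → a ≡ a′ × b ≡ b′) ×
        (∀ a a′ b b′ → T a b ≡ T a′ b′ → a ≡ a′ × b ≡ b′) ×
        (∀ a (c : Fin j → Fin (suc s)) b → 0 < P (place i₀ (λ i → S a i (c i)) (T a b)))
    find-disjoint zero _ = (λ ()) , (λ ()) , (λ _ ()) , (λ ()) , (λ ())
    find-disjoint (suc k) dense = extend (find-disjoint k
      (≤-trans (+-monoʳ-≤ _ (*-monoʳ-≤ (2 * Q) (m≤n+m (k * loss) loss))) dense))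
      where
      extend : _ → _
      extend (S , T , S-inj , T-inj , pos) =
        let S₀ , T₀ , S₀-inj , T₀-inj , pos₀ = find-partite j Q (λ w a → P′ (insertAt w i₀ a)) 2≤Q
              (λ w a → *-≤1 (P≤1 (insertAt w i₀ a)) (m∸n≤m 1 (hits (insertAt w i₀ a))))
              (subst (λ N → _ ≤ 2 * Q * N) (∑-insertAt n j i₀ P′) dense′) large
            -- Any transversal through the common vertex gives the contradiction; a constant choice
            -- provides one because the class sizes `suc s` and `suc t` are positive.
            S₀≢S : ∀ a i b b′ → S₀ i b ≢ S a i b′
            S₀≢S a i b b′ eq = miss-S a i b′ (place i₀ (λ l → S₀ l b) (T₀ zero)) (pos₀ (λ _ → b) zero)
              (trans (lookup-place i₀ _ _ i) eq)
            T₀≢T : ∀ a b b′ → T₀ b ≢ T a b′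
            T₀≢T a b b′ eq = miss-T a b′ (place i₀ (λ l → S₀ l zero) (T₀ b)) (pos₀ (λ _ → zero) b)
              (trans (lookup-place-i₀ i₀ _ _) eq)
        in (λ { zero → S₀ ; (suc a) → S a })
         , (λ { zero → T₀ ; (suc a) → T a })
         , (λ { i zero    zero     b b′ eq → refl , S₀-inj i b b′ eq
              ; i zero    (suc a′) b b′ eq → contradiction eq (S₀≢S a′ i b b′)
              ; i (suc a) zero     b b′ eq → contradiction (sym eq) (S₀≢S a i b′ b)
              ; i (suc a) (suc a′) b b′ eq → let p , q = S-inj i a a′ b b′ eq in cong suc p , q })
         , (λ { zero    zero     b b′ eq → refl , T₀-inj b b′ eq
              ; zero    (suc a′) b b′ eq → contradiction eq (T₀≢T a′ b b′)
              ; (suc a) zero     b b′ eq → contradiction (sym eq) (T₀≢T a b′ b)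
              ; (suc a) (suc a′) b b′ eq → let p , q = T-inj a a′ b b′ eq in cong suc p , q })
         , (λ { zero c b → 0<m*n⇒0<m (P (place i₀ (λ i → S₀ i (c i)) (T₀ b))) (pos₀ c b)
              ; (suc a) → pos a })
        where
        V = Vec (Fin n) (suc j)
        xs = tuples n (suc j)
        -- A used vertex is blocked at its own position only; the colouring keeps it from appearing
        -- at the others.
        at-S : Fin k → Fin j → Fin (suc s) → V → ℕ
        at-S a i b x = 𝟙 (lookup x (punchIn i₀ i) Fin.≟ S a i b)
        at-T : Fin k → Fin (suc t) → V → ℕ
        at-T a b x = 𝟙 (lookup x i₀ Fin.≟ T a b)
        hits-S hits-T : Fin k → V → ℕ
        hits-S a x = ∑ (allFin j) (λ i → ∑ (allFin (suc s)) (λ b → at-S a i b x))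
        hits-T a x = ∑ (allFin (suc t)) (λ b → at-T a b x)
        hits P′ : V → ℕ
        hits x = ∑ (allFin k) (λ a → hits-S a x + hits-T a x)
        P′ x = P x * (1 ∸ hits x)

        unhit : ∀ x → 0 < P′ x → hits x ≡ 0
        unhit x p with hits x | 0<m*n⇒0<n (P x) p
        ... | zero | _ = refl
        ... | suc h | q = contradiction (subst (0 <_) (0∸n≡0 h) q) λ ()

        miss-S : ∀ a i b x → 0 < P′ x → lookup x (punchIn i₀ i) ≢ S a i b
        miss-S a i b x p eq = n≮0 (begin-strict
          0                             <⟨ 𝟙⁺ (lookup x (punchIn i₀ i) Fin.≟ S a i b) eq ⟩
          at-S a i b x                  ≤⟨ ∑-∈ (λ b → at-S a i b x) (∈-allFin b) ⟩
          ∑ (allFin (suc s)) (λ b → at-S a i b x)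
                                        ≤⟨ ∑-∈ (λ i → ∑ (allFin (suc s)) (λ b → at-S a i b x)) (∈-allFin i) ⟩
          hits-S a x                    ≤⟨ m≤m+n _ _ ⟩
          hits-S a x + hits-T a x       ≤⟨ ∑-∈ (λ a → hits-S a x + hits-T a x) (∈-allFin a) ⟩
          hits x                        ≡⟨ unhit x p ⟩
          0                             ∎)
          where open ≤-Reasoning

        miss-T : ∀ a b x → 0 < P′ x → lookup x i₀ ≢ T a b
        miss-T a b x p eq = n≮0 (begin-strict
          0                             <⟨ 𝟙⁺ (lookup x i₀ Fin.≟ T a b) eq ⟩
          at-T a b x                    ≤⟨ ∑-∈ (λ b → at-T a b x) (∈-allFin b) ⟩
          hits-T a x                    ≤⟨ m≤n+m (hits-T a x) (hits-S a x) ⟩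
          hits-S a x + hits-T a x       ≤⟨ ∑-∈ (λ a → hits-S a x + hits-T a x) (∈-allFin a) ⟩
          hits x                        ≡⟨ unhit x p ⟩
          0                             ∎)
          where open ≤-Reasoning

        hit-bound : ∑ xs (λ x → P x * hits x) ≤ k * loss
        hit-bound = ∑-union-Fin k xs P _ λ a → begin
          ∑ xs (λ x → P x * (hits-S a x + hits-T a x))
            ≡⟨ ∑-cong xs (λ x → *-distribˡ-+ (P x) _ _) ⟩
          ∑ xs (λ x → P x * hits-S a x + P x * hits-T a x)
            ≡⟨ ∑-+ xs _ _ ⟩
          ∑ xs (λ x → P x * hits-S a x) + ∑ xs (λ x → P x * hits-T a x)
            ≤⟨ +-mono-≤
                 (∑-union-Fin j xs P _ λ i → ∑-union-Fin (suc s) xs P _ λ b → degree≤n^j P≤1 (punchIn i₀ i) (S a i b))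
                 (∑-union-Fin (suc t) xs P _ λ b → degree≤D (T a b)) ⟩
          loss ∎
          where open ≤-Reasoning

        P≤P′ : ∑ xs P ≤ ∑ xs P′ + k * loss
        P≤P′ = begin
          ∑ xs P                                       ≤⟨ ∑-mono xs pointwise ⟩
          ∑ xs (λ x → P′ x + P x * hits x)             ≡⟨ ∑-+ xs _ _ ⟩
          ∑ xs P′ + ∑ xs (λ x → P x * hits x)          ≤⟨ +-monoʳ-≤ _ hit-bound ⟩
          ∑ xs P′ + k * loss                           ∎
          where
          open ≤-Reasoning
          pointwise : ∀ x → P x ≤ P′ x + P x * hits x
          pointwise x = begin
            P x                              ≡⟨ *-identityʳ (P x) ⟨
            P x * 1                          ≤⟨ *-monoʳ-≤ (P x) (m≤n+m∸n 1 (hits x)) ⟩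
            P x * (hits x + (1 ∸ hits x))    ≡⟨ trans (*-distribˡ-+ (P x) _ _) (+-comm (P x * hits x) _) ⟩
            P′ x + P x * hits x              ∎

        dense′ : 3 * n ^ suc j ≤ 2 * Q * ∑ xs P′
        dense′ = +-cancelʳ-≤ (2 * Q * (k * loss)) _ _ (begin
          3 * n ^ suc j + 2 * Q * (k * loss)             ≤⟨ +-monoʳ-≤ _ (*-monoʳ-≤ (2 * Q) (m≤n+m (k * loss) loss)) ⟩
          3 * n ^ suc j + 2 * Q * (suc k * loss)         ≤⟨ dense ⟩
          2 * Q * ∑ xs P                                 ≤⟨ *-monoʳ-≤ (2 * Q) P≤P′ ⟩
          2 * Q * (∑ xs P′ + k * loss)                   ≡⟨ *-distribˡ-+ (2 * Q) _ _ ⟩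
          2 * Q * ∑ xs P′ + 2 * Q * (k * loss)           ∎)
          where open ≤-Reasoning

-- Arithmetic

-- (1 + 1/m) ^ k ≤ 1 + k/m + (k/m)² for k ≤ m, cleared of denominators.
[1+m]^k-bound : ∀ m k → k ≤ m → suc m ^ k * (m * m) ≤ m ^ k * (m * m + k * m + k * k)
[1+m]^k-bound m zero    _   = *-monoʳ-≤ 1 (≤-trans (m≤m+n _ 0) (m≤m+n _ 0))
[1+m]^k-bound m (suc k) k<m = begin
  suc m * suc m ^ k * (m * m)                               ≡⟨ *-assoc (suc m) (suc m ^ k) (m * m) ⟩
  suc m * (suc m ^ k * (m * m))                             ≤⟨ *-monoʳ-≤ (suc m) ([1+m]^k-bound m k (<⇒≤ k<m)) ⟩
  suc m * (m ^ k * (m * m + k * m + k * k))                 ≡⟨ e₁ m (m ^ k) k ⟩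
  m ^ k * (m * (m * m + k * m + k * k) + (m * m + k * m) + k * k)
                                                            ≤⟨ *-monoʳ-≤ (m ^ k) (+-monoʳ-≤ (m * (m * m + k * m + k * k) + (m * m + k * m)) kk≤) ⟩
  m ^ k * (m * (m * m + k * m + k * k) + (m * m + k * m) + (k * m + m))
                                                            ≡⟨ e₂ m (m ^ k) k ⟩
  m * m ^ k * (m * m + suc k * m + suc k * suc k)           ∎
  where
  open ≤-Reasoning
  kk≤ : k * k ≤ k * m + m
  kk≤ = ≤-trans (*-monoʳ-≤ k (<⇒≤ k<m)) (m≤m+n (k * m) m)
  e₁ : ∀ m p k → suc m * (p * (m * m + k * m + k * k)) ≡ p * (m * (m * m + k * m + k * k) + (m * m + k * m) + k * k)
  e₁ = solve-∀
  e₂ : ∀ m p k → p * (m * (m * m + k * m + k * k) + (m * m + k * m) + (k * m + m)) ≡ m * p * (m * m + suc k * m + suc k * suc k)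
  e₂ = solve-∀

[1+m]^m≤3m^m : ∀ m → suc m ^ m ≤ 3 * m ^ m
[1+m]^m≤3m^m zero      = s≤s z≤n
[1+m]^m≤3m^m m@(suc _) = *-cancelʳ-≤ (suc m ^ m) (3 * m ^ m) (m * m) (begin
  suc m ^ m * (m * m)                   ≤⟨ [1+m]^k-bound m m ≤-refl ⟩
  m ^ m * (m * m + m * m + m * m)       ≡⟨ e (m ^ m) (m * m) ⟩
  3 * m ^ m * (m * m)                   ∎)
  where
  open ≤-Reasoning
  e : ∀ p q → p * (q + q + q) ≡ 3 * p * q
  e = solve-∀

-- The ratio of consecutive values of m^m / m! is (1 + 1/m)^m, which is at most 3.
r^r≤3^r*r! : ∀ r → r ^ r ≤ 3 ^ r * r !
r^r≤3^r*r! zero    = ≤-refl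
r^r≤3^r*r! (suc m) = begin
  suc m * suc m ^ m               ≤⟨ *-monoʳ-≤ (suc m) ([1+m]^m≤3m^m m) ⟩
  suc m * (3 * m ^ m)             ≤⟨ *-monoʳ-≤ (suc m) (*-monoʳ-≤ 3 (r^r≤3^r*r! m)) ⟩
  suc m * (3 * (3 ^ m * m !))     ≡⟨ e (suc m) (3 ^ m) (m !) ⟩
  3 ^ suc m * suc m !             ∎
  where
  open ≤-Reasoning
  e : ∀ m p q → m * (3 * (p * q)) ≡ 3 * p * (m * q)
  e = solve-∀

-- Below c q a expresses q ≤ c (M/e)^a.
module _ {M e : ℕ} (0<e : 0 < e) (2e≤M : 2 * e ≤ M) where

  private instance
    e≢0 : NonZero e
    e≢0 = >-nonZero 0<e

  e≤M : e ≤ M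
  e≤M = ≤-trans (m≤m+n e (e + 0)) 2e≤M

  Below : ℕ → ℕ → ℕ → Set
  Below c q a = q * e ^ a ≤ c * M ^ a

  below-const : ∀ c → Below c c 0
  below-const c = ≤-refl

  below-≤ : ∀ {c q q′ a} → q ≤ q′ → Below c q′ a → Below c q a
  below-≤ {a = a} q≤q′ = ≤-trans (*-monoˡ-≤ (e ^ a) q≤q′)

  below-* : ∀ {c c′ q q′ a b} → Below c q a → Below c′ q′ b → Below (c * c′) (q * q′) (a + b)
  below-* {c} {c′} {q} {q′} {a} {b} p p′ = begin
    q * q′ * e ^ (a + b)           ≡⟨ cong (q * q′ *_) (^-distribˡ-+-* e a b) ⟩
    q * q′ * (e ^ a * e ^ b)       ≡⟨ *-interchange q q′ (e ^ a) (e ^ b) ⟩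
    q * e ^ a * (q′ * e ^ b)       ≤⟨ *-mono-≤ p p′ ⟩
    c * M ^ a * (c′ * M ^ b)       ≡⟨ *-interchange c (M ^ a) c′ (M ^ b) ⟩
    c * c′ * (M ^ a * M ^ b)       ≡⟨ cong (c * c′ *_) (^-distribˡ-+-* M a b) ⟨
    c * c′ * M ^ (a + b)           ∎
    where open ≤-Reasoning

  below-^ : ∀ {c q a} m → Below c q a → Below (c ^ m) (q ^ m) (m * a)
  below-^ zero    p = ≤-refl
  below-^ {c} {q} {a} (suc m) p = below-* {c} {c ^ m} {q} {q ^ m} {a} {m * a} p (below-^ {c} {q} {a} m p)

  below-^₁ : ∀ {q a} m → Below 1 q a → Below 1 (q ^ m) (m * a)
  below-^₁ {q} {a} m p = subst (λ c → Below c (q ^ m) (m * a)) (^-zeroˡ m) (below-^ {1} {q} {a} m p)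

  below-mono : ∀ {c q a b} → a ≤ b → Below c q a → Below c q b
  below-mono {c} {q} {a} {b} a≤b p = begin
    q * e ^ b                    ≡⟨ cong (λ x → q * e ^ x) (m+[n∸m]≡n a≤b) ⟨
    q * e ^ (a + (b ∸ a))        ≡⟨ split q e ⟩
    q * e ^ a * e ^ (b ∸ a)      ≤⟨ *-mono-≤ p (^-monoˡ-≤ (b ∸ a) e≤M) ⟩
    c * M ^ a * M ^ (b ∸ a)      ≡⟨ split c M ⟨
    c * M ^ (a + (b ∸ a))        ≡⟨ cong (λ x → c * M ^ x) (m+[n∸m]≡n a≤b) ⟩
    c * M ^ b                    ∎
    where
    open ≤-Reasoning
    split : ∀ q e → q * e ^ (a + (b ∸ a)) ≡ q * e ^ a * e ^ (b ∸ a)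
    split q e = trans (cong (q *_) (^-distribˡ-+-* e a (b ∸ a))) (sym (*-assoc q _ _))

  -- Since M/e ≥ 2, an absolute constant can be paid for by raising the exponent.
  below-2^ : ∀ m → Below 1 (2 ^ m) m
  below-2^ m = begin
    2 ^ m * e ^ m      ≡⟨ ^-distribʳ-* m 2 e ⟨
    (2 * e) ^ m        ≤⟨ ^-monoˡ-≤ m 2e≤M ⟩
    M ^ m              ≡⟨ *-identityˡ (M ^ m) ⟨
    1 * M ^ m          ∎
    where open ≤-Reasoning

  -- A round sends the exponent a to 3 + (s + 1) a, where the 3 pays for 5 ≤ 2^3. Shifted by 3, this
  -- is at most a multiplication by 2s: 6 + (s + 1) a ≤ 2s (a + 3).
  below-tower : ∀ s j Q a → 1 ≤ s → Below 1 Q a → Below 1 (tower s j Q) ((2 * s) ^ j * (a + 3))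
  below-tower s zero Q a 1≤s p =
    below-mono {1} {Q} {a} (≤-trans (m≤m+n a 3) (m≤m+n (a + 3) 0)) p
  below-tower s (suc j) Q a 1≤s p =
    below-mono {1} {tower s (suc j) Q} {(2 * s) ^ j * (3 + suc s * a + 3)} exponent
      (below-tower s j (5 * Q ^ suc s) (3 + suc s * a) 1≤s
        (below-* {1} {1} {5} {Q ^ suc s} {3} {suc s * a}
          (below-≤ {1} {5} {8} {3} (m≤m+n 5 3) (below-2^ 3)) (below-^₁ {Q} {a} (suc s) p)))
    where
    open ≤-Reasoning
    exponent : (2 * s) ^ j * (3 + suc s * a + 3) ≤ (2 * s) ^ suc j * (a + 3)
    exponent = begin
      (2 * s) ^ j * (3 + suc s * a + 3)          ≡⟨ cong ((2 * s) ^ j *_) (e₁ s a) ⟩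
      (2 * s) ^ j * (1 * 6 + (1 * a + s * a))    ≤⟨ *-monoʳ-≤ ((2 * s) ^ j) (+-mono-≤ (*-monoˡ-≤ 6 1≤s)
                                                      (+-monoˡ-≤ (s * a) (*-monoˡ-≤ a 1≤s))) ⟩
      (2 * s) ^ j * (s * 6 + (s * a + s * a))    ≡⟨ e₂ ((2 * s) ^ j) s a ⟩
      (2 * s) ^ suc j * (a + 3)                  ∎
      where
      e₁ : ∀ s a → 3 + suc s * a + 3 ≡ 1 * 6 + (1 * a + s * a)
      e₁ = solve-∀
      e₂ : ∀ p s a → p * (s * 6 + (s * a + s * a)) ≡ 2 * s * p * (a + 3)
      e₂ = solve-∀

  module _ {n p : ℕ} (M^p≤ : M ^ p ≤ n * e ^ p) where

    -- For p = (12 s)^(r-1) and M = n^r, the assumption `M^p≤` is the choice of s without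
    -- logarithms: (12 s)^(r-1) log (M/e) ≤ log n. As M/e ≥ 1, any exponent up to p is covered.
    below⇒≤n : ∀ {q a} → a ≤ p → Below 1 q a → q ≤ n
    below⇒≤n {q} {a} a≤p B = *-cancelʳ-≤ q n (e ^ p) {{m^n≢0 e p}} (begin
      q * e ^ p      ≤⟨ below-mono {1} {q} {a} a≤p B ⟩
      1 * M ^ p      ≡⟨ *-identityˡ (M ^ p) ⟩
      M ^ p          ≤⟨ M^p≤ ⟩
      n * e ^ p      ∎)
      where open ≤-Reasoning

    -- An exponent of at most 11p/12 uses only n^(11/12), which leaves n^(1/12) for the constant
    -- `c`; twelfth powers clear the fractions.
    below-c⇒≤n : ∀ {c q a} → 12 * a ≤ 11 * p → c ^ 12 ≤ n → Below c q a → q ≤ n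
    below-c⇒≤n {c} {q} {a} 12a≤11p c^12≤n B = ^-cancelʳ-≤ 11 {q} {n}
      (*-cancelʳ-≤ (q ^ 12) (n ^ 12) (e ^ (11 * p)) {{m^n≢0 e (11 * p)}} (begin
        q ^ 12 * e ^ (11 * p)               ≤⟨ below-mono {c ^ 12} {q ^ 12} {12 * a} 12a≤11p (below-^ {c} {q} {a} 12 B) ⟩
        c ^ 12 * M ^ (11 * p)               ≤⟨ *-monoˡ-≤ (M ^ (11 * p)) c^12≤n ⟩
        n * M ^ (11 * p)                    ≡⟨ cong (n *_) (power M) ⟨
        n * (M ^ p) ^ 11                    ≤⟨ *-monoʳ-≤ n (^-monoˡ-≤ 11 M^p≤) ⟩
        n * (n * e ^ p) ^ 11                ≡⟨ cong (n *_) (^-distribʳ-* 11 n (e ^ p)) ⟩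
        n * (n ^ 11 * (e ^ p) ^ 11)         ≡⟨ *-assoc n (n ^ 11) _ ⟨
        n ^ 12 * (e ^ p) ^ 11               ≡⟨ cong (n ^ 12 *_) (power e) ⟩
        n ^ 12 * e ^ (11 * p)               ∎))
      where
      open ≤-Reasoning
      power : ∀ m → (m ^ p) ^ 11 ≡ m ^ (11 * p)
      power m = trans (^-*-assoc m p 11) (cong (m ^_) (*-comm p 11))

    M^a≤ : ∀ {a} → a ≤ p → M ^ a ≤ n * e ^ a
    M^a≤ {a} a≤p = *-cancelʳ-≤ (M ^ a) (n * e ^ a) (e ^ (p ∸ a)) {{m^n≢0 e (p ∸ a)}} (begin
      M ^ a * e ^ (p ∸ a)          ≤⟨ *-monoʳ-≤ (M ^ a) (^-monoˡ-≤ (p ∸ a) e≤M) ⟩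
      M ^ a * M ^ (p ∸ a)          ≡⟨ ^-distribˡ-+-* M a (p ∸ a) ⟨
      M ^ (a + (p ∸ a))            ≡⟨ cong (M ^_) (m+[n∸m]≡n a≤p) ⟩
      M ^ p                        ≤⟨ M^p≤ ⟩
      n * e ^ p                    ≡⟨ cong (λ x → n * e ^ x) (m+[n∸m]≡n a≤p) ⟨
      n * e ^ (a + (p ∸ a))        ≡⟨ cong (n *_) (^-distribˡ-+-* e a (p ∸ a)) ⟩
      n * (e ^ a * e ^ (p ∸ a))    ≡⟨ *-assoc n _ _ ⟨
      n * e ^ a * e ^ (p ∸ a)      ∎)
      where open ≤-Reasoning

-- The left side is the coefficient of `(2 * s) ^ j` in the exponent of 4 times the squared tower: 2
-- (3 (j + 1) + 4) from the square and 2 from the 4. At j = 1 it would read 22 ≤ 6, so r = 2 is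
-- treated apart.
6j+16≤6^j : ∀ j → 2 ≤ j → 6 * j + 16 ≤ 6 ^ j
6j+16≤6^j 1 (s≤s ())
6j+16≤6^j 2 _ = m≤m+n 28 8
6j+16≤6^j (suc j@(suc (suc _))) _ = begin
  6 * suc j + 16                       ≡⟨ e₁ j ⟩
  6 * j + 22                           ≤⟨ m≤m+n _ (30 * j + 74) ⟩
  6 * j + 22 + (30 * j + 74)           ≡⟨ e₂ j ⟩
  6 * (6 * j + 16)                     ≤⟨ *-monoʳ-≤ 6 (6j+16≤6^j j (s≤s (s≤s z≤n))) ⟩
  6 ^ suc j                            ∎
  where
  open ≤-Reasoning
  e₁ : ∀ j → 6 * suc j + 16 ≡ 6 * j + 22
  e₁ = solve-∀
  e₂ : ∀ j → 6 * j + 22 + (30 * j + 74) ≡ 6 * (6 * j + 16)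
  e₂ = solve-∀

-- Justifies B = 8^r against γ = 3^r in `constants`; at r = 2 it would read 72 ≤ 64.
4r3^r≤8^r : ∀ r → 3 ≤ r → 4 * (r * 3 ^ r) ≤ 8 ^ r
4r3^r≤8^r 1 (s≤s ())
4r3^r≤8^r 2 (s≤s (s≤s ()))
4r3^r≤8^r 3 _ = m≤m+n 324 188
4r3^r≤8^r (suc r@(suc (suc (suc _)))) _ = begin
  4 * (suc r * (3 * 3 ^ r))                              ≡⟨ e₁ r (3 ^ r) ⟩
  4 * ((3 * r + 3) * 3 ^ r)                              ≤⟨ *-monoʳ-≤ 4 (*-monoˡ-≤ (3 ^ r) (+-monoʳ-≤ (3 * r) 3≤5r)) ⟩
  4 * ((3 * r + 5 * r) * 3 ^ r)                          ≡⟨ e₂ r (3 ^ r) ⟩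
  8 * (4 * (r * 3 ^ r))                                  ≤⟨ *-monoʳ-≤ 8 (4r3^r≤8^r r (s≤s (s≤s (s≤s z≤n)))) ⟩
  8 ^ suc r                                              ∎
  where
  open ≤-Reasoning
  3≤5r : 3 ≤ 5 * r
  3≤5r = ≤-trans (s≤s (s≤s (s≤s z≤n))) (m≤n*m r 5)
  e₁ : ∀ r p → 4 * (suc r * (3 * p)) ≡ 4 * ((3 * r + 3) * p)
  e₁ = solve-∀
  e₂ : ∀ r p → 4 * ((3 * r + 5 * r) * p) ≡ 8 * (4 * (r * p))
  e₂ = solve-∀

3rs≤[12s]^j : ∀ j s → 1 ≤ j → 1 ≤ s → 3 * suc j * s ≤ (12 * s) ^ j
3rs≤[12s]^j 1 s _ _ = ≤-trans (m≤m+n (6 * s) (6 * s)) (≤-reflexive (e s))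
  where
  e : ∀ s → 6 * s + 6 * s ≡ 12 * s * 1
  e = solve-∀
3rs≤[12s]^j (suc j@(suc _)) s _ 1≤s = begin
  3 * suc (suc j) * s                              ≤⟨ m≤m+n _ ((33 * j + 30) * s) ⟩
  3 * suc (suc j) * s + (33 * j + 30) * s          ≡⟨ e₁ j s ⟩
  12 * 1 * (3 * suc j * s)                         ≤⟨ *-mono-≤ (*-monoʳ-≤ 12 1≤s) (3rs≤[12s]^j j s (s≤s z≤n) 1≤s) ⟩
  12 * s * (12 * s) ^ j                            ∎
  where
  open ≤-Reasoning
  e₁ : ∀ j s → 3 * suc (suc j) * s + (33 * j + 30) * s ≡ 12 * 1 * (3 * suc j * s)
  e₁ = solve-∀

e≤3^r*m : ∀ r {e m} → e * r ! ≤ r ^ r * m → e ≤ 3 ^ r * m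
e≤3^r*m r {e} {m} p = *-cancelʳ-≤ e (3 ^ r * m) (r !) {{r !≢0}} (begin
  e * r !              ≤⟨ p ⟩
  r ^ r * m            ≤⟨ *-monoˡ-≤ m (r^r≤3^r*r! r) ⟩
  3 ^ r * r ! * m      ≡⟨ swap (3 ^ r) (r !) m ⟩
  3 ^ r * m * r !      ∎)
  where
  open ≤-Reasoning
  swap : ∀ a b c → a * b * c ≡ a * c * b
  swap = solve-∀

below-linear : ∀ {M e} (0<e : 0 < e) (2e≤M : 2 * e ≤ M) k {Q} →
  Q * e ≤ 2 ^ k * M → Below 0<e 2e≤M 1 Q (suc k)
below-linear {M} {e} 0<e 2e≤M k {Q} p = begin
  Q * (e * e ^ k)           ≡⟨ *-assoc Q e (e ^ k) ⟨
  Q * e * e ^ k             ≤⟨ *-monoˡ-≤ (e ^ k) p ⟩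
  2 ^ k * M * e ^ k         ≡⟨ swap (2 ^ k) M (e ^ k) ⟩
  M * (2 ^ k * e ^ k)       ≤⟨ *-monoʳ-≤ M (below-2^ 0<e 2e≤M k) ⟩
  M * (1 * M ^ k)           ≡⟨ swap′ M (M ^ k) ⟩
  1 * (M * M ^ k)           ∎
  where
  open ≤-Reasoning
  swap : ∀ a b c → a * b * c ≡ b * (a * c)
  swap = solve-∀
  swap′ : ∀ a b → a * (1 * b) ≡ 1 * (a * b)
  swap′ = solve-∀

4[5q]²≡100q² : ∀ q → 4 * (5 * q) ^ 2 ≡ 100 * q ^ 2
4[5q]²≡100q² = e
  where
  e : ∀ q → 4 * (5 * q * (5 * q * 1)) ≡ 100 * (q * (q * 1))
  e = solve-∀

-- For r = 2 the exponents leave no room to absorb the factors 100 and 16, which are instead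
-- bounded by a small power of n.
tower-bound₁ : ∀ {M e n} → 0 < e → 2 * e ≤ M → ∀ s Q → 1 ≤ s → M ^ ((12 * s) ^ 1) ≤ n * e ^ ((12 * s) ^ 1) →
  (100 * 16 ^ 4) ^ 12 ≤ n → Q * e ≤ 16 * M → 4 * tower s 1 Q ^ 2 ≤ n
tower-bound₁ {M} {e} {n} 0<e 2e≤M 1 Q _ M^p≤ c^12≤n Qe≤ =
  ≤-trans (≤-reflexive (trans (4[5q]²≡100q² (Q ^ 2)) (cong (100 *_) (^-*-assoc Q 2 2))))
    (below-c⇒≤n 0<e 2e≤M {n} {12} M^p≤ {100 * 16 ^ 4} {100 * Q ^ 4} {0 + 4 * 1} (m≤m+n 48 84) c^12≤n
      (below-* 0<e 2e≤M {100} {16 ^ 4} {100} {Q ^ 4} {0} {4 * 1} (below-const 0<e 2e≤M 100)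
        (below-^ 0<e 2e≤M {16} {Q} {1} 4 Q≲)))
  where
  Q≲ : Below 0<e 2e≤M 16 Q 1
  Q≲ = subst₂ _≤_ (cong (Q *_) (sym (*-identityʳ e))) (cong (16 *_) (sym (*-identityʳ M))) Qe≤
-- The number of factors `Q` now grows with s, so the 16 cannot be kept in each of them. Of the 2s +
-- 2 factors, 2s use Q ≤ (M/e)^5 and two keep their 16. The condition 12 (10 s + 2) ≤ 11 (12 s)
-- holds exactly from s = 2 on.
tower-bound₁ {M} {e} {n} 0<e 2e≤M s@(suc (suc s″)) Q _ M^p≤ c^12≤n Qe≤ =
  ≤-trans (≤-reflexive (trans (4[5q]²≡100q² (Q ^ suc s)) (cong (100 *_) square)))
    (below-c⇒≤n 0<e 2e≤M {n} {(12 * s) ^ 1} M^p≤ {100 * (1 * 16 ^ 2)} {100 * (Q ^ (2 * s) * Q ^ 2)}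
      {0 + (2 * s * 5 + 2 * 1)} exponent
      (≤-trans (^-monoˡ-≤ 12 (m≤m+n 25600 6528000)) c^12≤n)
      (below-* 0<e 2e≤M {100} {1 * 16 ^ 2} {100} {Q ^ (2 * s) * Q ^ 2} {0} {2 * s * 5 + 2 * 1}
        (below-const 0<e 2e≤M 100)
        (below-* 0<e 2e≤M {1} {16 ^ 2} {Q ^ (2 * s)} {Q ^ 2} {2 * s * 5} {2 * 1}
          (below-^₁ 0<e 2e≤M {Q} {5} (2 * s) (below-linear 0<e 2e≤M 4 {Q} Qe≤))
          (below-^ 0<e 2e≤M {16} {Q} {1} 2 Q≲))))
  where
  Q≲ : Below 0<e 2e≤M 16 Q 1
  Q≲ = subst₂ _≤_ (cong (Q *_) (sym (*-identityʳ e))) (cong (16 *_) (sym (*-identityʳ M))) Qe≤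
  square : (Q ^ suc s) ^ 2 ≡ Q ^ (2 * s) * Q ^ 2
  square = trans (^-*-assoc Q (suc s) 2)
    (trans (cong (Q ^_) (trans (*-comm (suc s) 2) (double s))) (^-distribˡ-+-* Q (2 * s) 2))
    where
    double : ∀ s → 2 * suc s ≡ 2 * s + 2
    double = solve-∀
  exponent : 12 * (0 + (2 * s * 5 + 2 * 1)) ≤ 11 * (12 * s) ^ 1
  exponent = ≤-trans (m≤m+n _ (12 * s″)) (≤-reflexive (arith s″))
    where
    arith : ∀ s → 12 * (0 + (2 * (2 + s) * 5 + 2 * 1)) + 12 * s ≡ 11 * (12 * (2 + s) * 1)
    arith = solve-∀

-- For r ≥ 3 all constants go into the exponent: in (12 s)^j = 6^j (2 s)^j the factor 6^j covers the
-- 8^r in `Q`, the 5 of each round, the square and the 4.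
tower-bound : ∀ {M e n} → 0 < e → 2 * e ≤ M → ∀ j s Q → 2 ≤ j → 1 ≤ s →
  M ^ ((12 * s) ^ j) ≤ n * e ^ ((12 * s) ^ j) →
  Q * e ≤ 8 ^ suc j * M → 4 * tower s j Q ^ 2 ≤ n
tower-bound {M} {e} {n} 0<e 2e≤M j s Q 2≤j 1≤s M^p≤ Qe≤ =
  below⇒≤n 0<e 2e≤M {n} {(12 * s) ^ j} M^p≤ {4 * tower s j Q ^ 2} {2 + 2 * ((2 * s) ^ j * (1 + 3 * suc j + 3))} exponent
    (below-* 0<e 2e≤M {1} {1} {4} {tower s j Q ^ 2} {2} {2 * ((2 * s) ^ j * (1 + 3 * suc j + 3))}
      (below-2^ 0<e 2e≤M 2)
      (below-^₁ 0<e 2e≤M {tower s j Q} {(2 * s) ^ j * (1 + 3 * suc j + 3)} 2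
        (below-tower 0<e 2e≤M s j Q (1 + 3 * suc j) 1≤s
          (below-linear 0<e 2e≤M (3 * suc j) {Q}
            (subst (λ B → Q * e ≤ B * M) (^-*-assoc 2 3 (suc j)) Qe≤)))))
  where
  open ≤-Reasoning
  exponent : 2 + 2 * ((2 * s) ^ j * (1 + 3 * suc j + 3)) ≤ (12 * s) ^ j
  exponent = begin
    2 * 1 + 2 * ((2 * s) ^ j * (1 + 3 * suc j + 3))
      ≤⟨ +-monoˡ-≤ _ (*-monoʳ-≤ 2 (m^n>0 (2 * s) {{>-nonZero (*-pos {2} (s≤s z≤n) 1≤s)}} j)) ⟩
    2 * (2 * s) ^ j + 2 * ((2 * s) ^ j * (1 + 3 * suc j + 3))
      ≡⟨ collect ((2 * s) ^ j) j ⟩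
    (6 * j + 16) * (2 * s) ^ j
      ≤⟨ *-monoˡ-≤ ((2 * s) ^ j) (6j+16≤6^j j 2≤j) ⟩
    6 ^ j * (2 * s) ^ j
      ≡⟨ ^-distribʳ-* j 6 (2 * s) ⟨
    (6 * (2 * s)) ^ j
      ≡⟨ cong (_^ j) (*-assoc 6 2 s) ⟨
    (12 * s) ^ j ∎
    where
    collect : ∀ p j → 2 * p + 2 * (p * (1 + 3 * suc j + 3)) ≡ (6 * j + 16) * p
    collect = solve-∀

-- `γ` bounds e/m, and `B` fixes Q at about B M/e; the summand 4 pays for rounding Q down. For r = 2
-- the exact ratio 2^2/2! = 2 serves as `γ`, and B = 16 turns the numerical condition into an
-- equality.
constants : ∀ j → 1 ≤ j → ∃ λ B → ∃ λ γ → 0 < γ × 3 ≤ B × 15 * (suc j * γ) + 4 ≤ 4 * B ×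
  (∀ {e m} → e * suc j ! ≤ suc j ^ suc j * m → e ≤ γ * m) ×
  (∀ {M e n} → 0 < e → 2 * e ≤ M → ∀ s Q → 1 ≤ s → M ^ ((12 * s) ^ j) ≤ n * e ^ ((12 * s) ^ j) →
    (100 * 16 ^ 4) ^ 12 ≤ n → Q * e ≤ B * M → 4 * tower s j Q ^ 2 ≤ n)
constants 1 _ = 16 , 2 , s≤s z≤n , m≤m+n 3 13 , ≤-refl ,
  (λ {e} {m} p → *-cancelʳ-≤ e (2 * m) 2 (≤-trans p (≤-reflexive (four m)))) , tower-bound₁
  where
  four : ∀ m → 4 * m ≡ 2 * m * 2
  four = solve-∀
constants j@(suc (suc i)) _ = 8 ^ r , 3 ^ r , m^n>0 3 r , 3≤8^r , arith , e≤3^r*m r ,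
  λ 0<e 2e≤M s Q 1≤s M^p≤ _ Qe≤ → tower-bound 0<e 2e≤M j s Q (s≤s (s≤s z≤n)) 1≤s M^p≤ Qe≤
  where
  open ≤-Reasoning
  r = suc j
  3≤8^r : 3 ≤ 8 ^ r
  3≤8^r = ≤-trans (m≤m+n 3 5) (≤-trans (≤-reflexive (sym (*-identityʳ 8))) (*-monoʳ-≤ 8 (m^n>0 8 j)))
  4≤r3^r : 4 ≤ r * 3 ^ r
  4≤r3^r = ≤-trans (m≤m+n 4 5) (*-mono-≤ {3} {r} {3} (s≤s (s≤s (s≤s z≤n))) (*-monoʳ-≤ 3 (m^n>0 3 j)))
  arith : 15 * (r * 3 ^ r) + 4 ≤ 4 * 8 ^ r
  arith = begin
    15 * (r * 3 ^ r) + 4                   ≤⟨ +-monoʳ-≤ (15 * (r * 3 ^ r)) 4≤r3^r ⟩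
    15 * (r * 3 ^ r) + r * 3 ^ r           ≡⟨ sixteen (r * 3 ^ r) ⟩
    4 * (4 * (r * 3 ^ r))                  ≤⟨ *-monoʳ-≤ 4 (4r3^r≤8^r r (s≤s (s≤s (s≤s z≤n)))) ⟩
    4 * 8 ^ r                              ∎
    where
    sixteen : ∀ x → 15 * x + x ≡ 4 * (4 * x)
    sixteen = solve-∀

-- In the r-th power the n from `t ^ r` meets the n in `many`, and `D ^ r ≤ m ^ j` completes m to
-- m^r. The 6 against the 3 leaves the factor 2.
T-loss : ∀ j k t n {e m D} → e ≤ 3 ^ suc j * m → (6 * suc j * k) ^ suc j * n ≤ e → t ^ suc j ≤ n →
  D ^ suc j ≤ m ^ j → 2 * (suc j * (k * (t * D))) ≤ m
T-loss j k t n {e} {m} {D} e≤3^r*m many t^r≤n D^r≤ = *-cancelˡ-≤ 3 (≤-trans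
  (≤-reflexive (reorder (suc j) k t D)) (^-cancelʳ-≤ j {6 * suc j * k * (t * D)} {3 * m} (begin
  (6 * r * k * (t * D)) ^ r            ≡⟨ ^-distribʳ-* r (6 * r * k) (t * D) ⟩
  (6 * r * k) ^ r * (t * D) ^ r        ≡⟨ cong ((6 * r * k) ^ r *_) (^-distribʳ-* r t D) ⟩
  (6 * r * k) ^ r * (t ^ r * D ^ r)    ≤⟨ *-monoʳ-≤ ((6 * r * k) ^ r) (*-mono-≤ t^r≤n D^r≤) ⟩
  (6 * r * k) ^ r * (n * m ^ j)        ≡⟨ *-assoc ((6 * r * k) ^ r) n (m ^ j) ⟨
  (6 * r * k) ^ r * n * m ^ j          ≤⟨ *-monoˡ-≤ (m ^ j) (≤-trans many e≤3^r*m) ⟩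
  3 ^ r * m * m ^ j                    ≡⟨ *-assoc (3 ^ r) m (m ^ j) ⟩
  3 ^ r * m ^ r                        ≡⟨ ^-distribʳ-* r 3 m ⟨
  (3 * m) ^ r                          ∎)))
  where
  open ≤-Reasoning
  r = suc j
  reorder : ∀ r k t D → 3 * (2 * (r * (k * (t * D)))) ≡ 6 * r * k * (t * D)
  reorder = solve-∀

-- As k ≤ n^(j/r), the product k n^j is at most n^(r - 1/r). The room n^(1/r) is split in three:
-- `C`, `s` and M/e are each at most n^(1/(3r)), hence the power 3r.
S-loss : ∀ {e n} (0<e : 0 < e) j k s C → 2 * e ≤ n ^ suc j → 1 ≤ j → 1 ≤ s →
  (n ^ suc j) ^ ((12 * s) ^ j) ≤ n * e ^ ((12 * s) ^ j) → (6 * suc j * k) ^ suc j * n ≤ e →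
  C ^ (3 * suc j) ≤ n → 0 < n → C * (k * (s * n ^ j)) ≤ e
S-loss {e} {n@(suc _)} 0<e j k s C 2e≤M 1≤j 1≤s M^p≤ many C^3r≤n _ =
  ^-cancelʳ-≤ (j + 2 * r) {C * (k * (s * N))} {e} (*-cancelˡ-≤ n (begin
    n * (C * (k * (s * N))) ^ (3 * r)
      ≡⟨ cong (n *_) expand ⟩
    n * (C ^ (3 * r) * ((k ^ r) ^ 3 * (s ^ (3 * r) * N ^ (3 * r))))
      ≤⟨ *-monoʳ-≤ n (*-mono-≤ C^3r≤n (*-mono-≤ (^-monoˡ-≤ 3 k^r≤N) (*-monoˡ-≤ (N ^ (3 * r)) s^3r≤n))) ⟩
    n * (n * (N ^ 3 * (n * N ^ (3 * r))))
      ≡⟨ collect n (N ^ 3) (N ^ (3 * r)) ⟩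
    n ^ 3 * N ^ 3 * N ^ (3 * r)
      ≡⟨ cong (_* N ^ (3 * r)) powers ⟨
    n ^ (3 * r) * N ^ (3 * r)
      ≡⟨ ^-distribʳ-* (3 * r) n N ⟨
    M ^ (3 * r)
      ≤⟨ M^a≤ 0<e 2e≤M {n} {(12 * s) ^ j} M^p≤ {3 * r} 3r≤p ⟩
    n * e ^ (3 * r) ∎))
  where
  open ≤-Reasoning
  r = suc j
  N = n ^ j
  M = n ^ r
  3rs≤p : 3 * r * s ≤ (12 * s) ^ j
  3rs≤p = 3rs≤[12s]^j j s 1≤j 1≤s
  3r≤p : 3 * r ≤ (12 * s) ^ j
  3r≤p = ≤-trans (≤-trans (≤-reflexive (sym (*-identityʳ (3 * r)))) (*-monoʳ-≤ (3 * r) 1≤s)) 3rs≤p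
  s^3r≤n : s ^ (3 * r) ≤ n
  s^3r≤n = ≤-trans (^-monoˡ-≤ (3 * r) (<⇒≤ (m<2^m s)))
    (below⇒≤n 0<e 2e≤M {n} {(12 * s) ^ j} M^p≤ {(2 ^ s) ^ (3 * r)} {3 * r * s} 3rs≤p
      (below-^₁ 0<e 2e≤M {2 ^ s} {s} (3 * r) (below-2^ 0<e 2e≤M s)))
  k^r≤N : k ^ r ≤ N
  k^r≤N = *-cancelʳ-≤ (k ^ r) N n (begin
    k ^ r * n                  ≤⟨ *-monoˡ-≤ n (^-monoˡ-≤ r (m≤n*m k (6 * r))) ⟩
    (6 * r * k) ^ r * n        ≤⟨ many ⟩
    e                          ≤⟨ e≤M 0<e 2e≤M ⟩
    n * N                      ≡⟨ *-comm n N ⟩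
    N * n                      ∎)
  expand : (C * (k * (s * N))) ^ (3 * r) ≡ C ^ (3 * r) * ((k ^ r) ^ 3 * (s ^ (3 * r) * N ^ (3 * r)))
  expand = trans (^-distribʳ-* (3 * r) C _) (cong (C ^ (3 * r) *_)
    (trans (^-distribʳ-* (3 * r) k _) (cong₂ _*_
      (trans (cong (k ^_) (*-comm 3 r)) (sym (^-*-assoc k r 3)))
      (^-distribʳ-* (3 * r) s N))))
  collect : ∀ n a b → n * (n * (a * (n * b))) ≡ n * (n * (n * 1)) * a * b
  collect = solve-∀
  powers : n ^ (3 * r) ≡ n ^ 3 * N ^ 3
  powers = trans (cong (n ^_) (exponent j)) (trans (^-distribˡ-+-* n 3 (j * 3))
    (cong (n ^ 3 *_) (sym (^-*-assoc n j 3))))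
    where
    exponent : ∀ j → 3 * suc j ≡ 3 + j * 3
    exponent = solve-∀

-- Disjoint copies in a hypergraph with many edges

quotient-density : ∀ r {M e m B γ Q} → 0 < γ → 15 * (r * γ) + 4 ≤ 4 * B → e ≤ γ * m →
  B * M ≤ Q * e + M → 15 * (r * M) ≤ 4 * (Q * m)
quotient-density r {M} {e} {m} {B} {γ@(suc _)} {Q} _ 15rγ≤4B e≤γm BM≤ =
  *-cancelˡ-≤ γ (+-cancelʳ-≤ (4 * M) _ _ (begin
    γ * (15 * (r * M)) + 4 * M          ≡⟨ e₁ γ r M ⟩
    (15 * (r * γ) + 4) * M              ≤⟨ *-monoˡ-≤ M 15rγ≤4B ⟩
    4 * B * M                           ≡⟨ *-assoc 4 B M ⟩
    4 * (B * M)                         ≤⟨ *-monoʳ-≤ 4 BM≤ ⟩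
    4 * (Q * e + M)                     ≤⟨ *-monoʳ-≤ 4 (+-monoˡ-≤ M (*-monoʳ-≤ Q e≤γm)) ⟩
    4 * (Q * (γ * m) + M)               ≡⟨ e₂ Q γ m M ⟩
    γ * (4 * (Q * m)) + 4 * M           ∎))
  where
  open ≤-Reasoning
  e₁ : ∀ γ r M → γ * (15 * (r * M)) + 4 * M ≡ (15 * (r * γ) + 4) * M
  e₁ = solve-∀
  e₂ : ∀ Q γ m M → 4 * (Q * (γ * m) + M) ≡ γ * (4 * (Q * m)) + 4 * M
  e₂ = solve-∀

-- Of the m/r tuples the s-classes destroy at most m/(10r) and the t-classes at most m/(2r). The
-- remaining 2m/(5r) is at least 3M/(2Q), because m ≥ 15 r M/(4Q).
density : ∀ j k s t N {M m p Q D} → 15 * (suc j * M) ≤ 4 * (Q * m) → m ≤ suc j * p →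
  10 * (suc j * j) * (k * (s * N)) ≤ m → 2 * (suc j * (k * (t * D))) ≤ m →
  3 * M + 2 * Q * (k * (j * (s * N) + t * D)) ≤ 2 * Q * p
density j k s t N {M} {m} {p} {Q} {D} 15rM≤ m≤rp S≤ T≤ = *-cancelˡ-≤ (10 * suc j) (begin
  10 * suc j * (3 * M + 2 * Q * (k * (j * (s * N) + t * D)))
    ≡⟨ e₁ j k s t N M Q D ⟩
  2 * (15 * (suc j * M)) + 2 * (Q * (10 * (suc j * j) * (k * (s * N)) + 5 * (2 * (suc j * (k * (t * D))))))
    ≤⟨ +-mono-≤ (*-monoʳ-≤ 2 15rM≤) (*-monoʳ-≤ 2 (*-monoʳ-≤ Q (+-mono-≤ S≤ (*-monoʳ-≤ 5 T≤)))) ⟩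
  2 * (4 * (Q * m)) + 2 * (Q * (m + 5 * m))
    ≡⟨ e₂ Q m ⟩
  20 * (Q * m)
    ≤⟨ *-monoʳ-≤ 20 (*-monoʳ-≤ Q m≤rp) ⟩
  20 * (Q * (suc j * p))
    ≡⟨ e₃ Q j p ⟩
  10 * suc j * (2 * Q * p) ∎)
  where
  open ≤-Reasoning
  e₁ : ∀ j k s t N M Q D → 10 * suc j * (3 * M + 2 * Q * (k * (j * (s * N) + t * D))) ≡
    2 * (15 * (suc j * M)) + 2 * (Q * (10 * (suc j * j) * (k * (s * N)) + 5 * (2 * (suc j * (k * (t * D))))))
  e₁ = solve-∀
  e₂ : ∀ Q m → 2 * (4 * (Q * m)) + 2 * (Q * (m + 5 * m)) ≡ 20 * (Q * m)
  e₂ = solve-∀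
  e₃ : ∀ Q j p → 20 * (Q * (suc j * p)) ≡ 10 * suc j * (2 * Q * p)
  e₃ = solve-∀

-- The summands serve `S-loss`, the constants of `tower-bound₁`, and the positivity of n. The factor
-- r^r in the first converts a bound by e into a bound by m.
threshold : ℕ → ℕ
threshold j = (suc j ^ suc j * (10 * (suc j * j))) ^ (3 * suc j) + (100 * 16 ^ 4) ^ 12 + 1

module _ (j : ℕ) (1≤j : 1 ≤ j) (n : ℕ) (N≤n : threshold j ≤ n) (G : RGraph (suc j) n) where

  private
    r = suc j
    e = edgeCount G
    C = suc j ^ suc j * (10 * (suc j * j))

  C^3r≤n : C ^ (3 * r) ≤ n
  C^3r≤n = ≤-trans (m≤m+n (C ^ (3 * r)) _) (≤-trans (m≤m+n _ 1) N≤n)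

  c^12≤n : (100 * 16 ^ 4) ^ 12 ≤ n
  c^12≤n = ≤-trans (m≤n+m _ (C ^ (3 * r))) (≤-trans (m≤m+n _ 1) N≤n)

  0<n : 0 < n
  0<n = ≤-trans (m≤n+m 1 (C ^ (3 * r) + (100 * 16 ^ 4) ^ 12)) N≤n

  2e≤n^r : 2 * e ≤ n ^ r
  2e≤n^r = ≤-trans (≤-trans (≤-reflexive (*-comm 2 e)) (*-monoʳ-≤ e (*-mono-≤ (s≤s 1≤j) (1≤n! j))))
                   (edgeCount*r!≤n^r G)

  module _ (k s t : ℕ)
           (M^p≤ : (n ^ r) ^ ((12 * suc s) ^ j) ≤ n * e ^ ((12 * suc s) ^ j))
           (t^r≤n : suc t ^ r ≤ n) (many : (6 * r * k) ^ r * n ≤ e) where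

    0<e : 0 < e
    0<e = n≢0⇒n>0 λ e≡0 → <⇒≱ (m^n>0 (n ^ r) {{m^n≢0 n r {{>-nonZero 0<n}}}} ((12 * suc s) ^ j))
      (≤-trans M^p≤ (≤-reflexive (trans (cong (λ e → n * e ^ ((12 * suc s) ^ j)) e≡0)
        (trans (cong (n *_) (0^ ((12 * suc s) ^ j) (m^n>0 (12 * suc s) {{>-nonZero (s≤s z≤n)}} j)))
               (*-zeroʳ n)))))
      where
      0^ : ∀ p → 0 < p → 0 ^ p ≡ 0
      0^ (suc p) _ = refl

    private instance
      e≢0 : NonZero e
      e≢0 = >-nonZero 0<e

    -- As r ≥ 2, the t-class has size at most n^(1/2), and the tower may use the other n^(1/2). This
    -- is the origin of the square in the tower bounds.
    large : ∀ q → 4 * q ^ 2 ≤ n → 2 * suc t * q ≤ n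
    large q 4q²≤n = ^-cancelʳ-≤ 1 {2 * suc t * q} {n} (begin
      (2 * suc t * q) ^ 2                ≡⟨ e₁ (suc t) q ⟩
      suc t ^ 2 * (4 * q ^ 2)            ≤⟨ *-mono-≤ (≤-trans (^-monoʳ-≤ (suc t) (s≤s 1≤j)) t^r≤n) 4q²≤n ⟩
      n * n                              ≡⟨ cong (n *_) (*-identityʳ n) ⟨
      n ^ 2                              ∎)
      where
      open ≤-Reasoning
      e₁ : ∀ t q → 2 * t * q * (2 * t * q * 1) ≡ t * (t * 1) * (4 * (q * (q * 1)))
      e₁ = solve-∀

    BM≤ : ∀ B → B * n ^ r ≤ B * n ^ r / e * e + n ^ r
    BM≤ B = begin
      B * n ^ r                                      ≡⟨ m≡m%n+[m/n]*n (B * n ^ r) e ⟩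
      B * n ^ r % e + B * n ^ r / e * e              ≡⟨ +-comm (B * n ^ r % e) _ ⟩
      B * n ^ r / e * e + B * n ^ r % e              ≤⟨ +-monoʳ-≤ (B * n ^ r / e * e)
                                                          (≤-trans (<⇒≤ (m%n<n (B * n ^ r) e)) (e≤M 0<e 2e≤n^r)) ⟩
      B * n ^ r / e * e + n ^ r                      ∎
      where open ≤-Reasoning

    2≤quotient : ∀ B → 3 ≤ B → 2 ≤ B * n ^ r / e
    2≤quotient B 3≤B = ≮⇒≥ λ { (s≤s Q≤1) → <⇒≱ 0<M (+-cancelˡ-≤ (2 * M) M 0 (begin
      2 * M + M                   ≡⟨ e₁ M ⟩
      3 * M                       ≤⟨ *-monoˡ-≤ M 3≤B ⟩
      B * M                       ≤⟨ BM≤ B ⟩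
      B * M / e * e + M           ≤⟨ +-monoˡ-≤ M (*-mono-≤ Q≤1 (e≤M 0<e 2e≤n^r)) ⟩
      1 * M + M                   ≡⟨ e₂ M ⟩
      2 * M + 0                   ∎)) }
      where
      open ≤-Reasoning
      M = n ^ r
      0<M : 0 < M
      0<M = m^n>0 n {{>-nonZero 0<n}} r
      e₁ : ∀ M → 2 * M + M ≡ 3 * M
      e₁ = solve-∀
      e₂ : ∀ M → 1 * M + M ≡ 2 * M + 0
      e₂ = solve-∀

    Copies : Set
    Copies = ∃ λ (i₀ : Fin r) → ∃ λ (f : Fin n → Fin r) →
      ∃ λ (S : Fin k → Fin j → Fin (suc s) → Fin n) → ∃ λ (T : Fin k → Fin (suc t) → Fin n) →
        (∀ i a a′ b b′ → S a i b ≡ S a′ i b′ → a ≡ a′ × b ≡ b′) ×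
        (∀ a a′ b b′ → T a b ≡ T a′ b′ → a ≡ a′ × b ≡ b′) ×
        (∀ a (c : Fin j → Fin (suc s)) b → let x = place i₀ (λ i → S a i (c i)) (T a b) in
           (∀ i → f (lookup x i) ≡ i) × image (lookup x) ∈ edges G)

    copies : Copies
    copies = coloured (rainbow-colouring (isEdge G) (isEdge⇒injective G))
      where
      coloured : (∃ λ (f : Fin n → Fin r) → ∑ (tuples n r) (isEdge G) ≤
        r ^ r * ∑ (tuples n r) (λ x → isEdge G x * 𝟙 (rainbow? f x))) → Copies
      coloured (f , ∑isEdge≤) = charged (low-degree-class R R≤1)
        where
        R : Vec (Fin n) r → ℕ
        R x = isEdge G x * 𝟙 (rainbow? f x)
        R≤1 : ∀ x → R x ≤ 1
        R≤1 x = *-≤1 (isEdge≤1 G x) (𝟙≤1 (rainbow? f x))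
        m = ∑ (tuples n r) R
        e*r!≤ : e * r ! ≤ r ^ r * m
        e*r!≤ = ≤-trans (≤-reflexive (sym (∑-isEdge G))) ∑isEdge≤
        S-loss≤m : 10 * (r * j) * (k * (suc s * n ^ j)) ≤ m
        S-loss≤m = *-cancelˡ-≤ (r ^ r) {{m^n≢0 r r}} (begin
          r ^ r * (10 * (r * j) * (k * (suc s * n ^ j)))  ≡⟨ *-assoc (r ^ r) (10 * (r * j)) _ ⟨
          C * (k * (suc s * n ^ j))                       ≤⟨ S-loss 0<e j k (suc s) C 2e≤n^r 1≤j (s≤s z≤n) M^p≤ many C^3r≤n 0<n ⟩
          e                                               ≤⟨ m≤m*n e (r !) {{r !≢0}} ⟩
          e * r !                                         ≤⟨ e*r!≤ ⟩
          r ^ r * m                                       ∎)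
          where open ≤-Reasoning

        charged : (∃ λ i → ∃ λ P → ∃ λ D → (∀ x → P x ≤ R x) × m ≤ r * ∑ (tuples n r) P ×
          (∀ y → degree P i y ≤ D) × D ^ r ≤ m ^ j) → Copies
        charged (i₀ , P , D , P≤R , m≤rP , degree≤D , D^r≤) = found (constants j 1≤j)
          where
          found : _ → Copies
          found (B , γ , 0<γ , 3≤B , 15rγ≤4B , e≤γm , tower≤) = finish
            (find-disjoint i₀ P (λ x → ≤-trans (P≤R x) (R≤1 x)) D Q degree≤D (2≤quotient B 3≤B)
              (large (tower (suc s) j Q)
                (tower≤ 0<e 2e≤n^r (suc s) Q (s≤s z≤n) M^p≤ c^12≤n (m/n*n≤m (B * n ^ r) e)))
              k
              (density j k (suc s) (suc t) (n ^ j) {n ^ r} {m} {∑ (tuples n r) P} {Q} {D}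
                (quotient-density r {n ^ r} {e} {m} {B} {γ} {Q} 0<γ 15rγ≤4B (e≤γm e*r!≤) (BM≤ B))
                m≤rP S-loss≤m
                (T-loss j k (suc t) n (e≤3^r*m r e*r!≤) many t^r≤n D^r≤)))
            where
            -- Rounded down, so that `Q * e ≤ B * n ^ r` is available for the tower; `BM≤` limits
            -- what the rounding costs in density.
            Q = B * n ^ r / e
            finish : _ → Copies
            finish (S , T , S-inj , T-inj , pos) = i₀ , f , S , T , S-inj , T-inj , λ a c b →
              let x   = place i₀ (λ i → S a i (c i)) (T a b)
                  0<R = ≤-trans (pos a c b) (P≤R x)
              in 𝟙⁻ (rainbow? f x) (0<m*n⇒0<n (isEdge G x) 0<R)
               , isEdge⇒∈ G x (0<m*n⇒0<m (isEdge G x) 0<R)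

-- Vertices of K_r(s,…,s,t)

module _ {j s t : ℕ} where

  -- Stands in for `KVert`, whose class sizes are hidden in an `if`; a sum can be matched on
  -- directly.
  Slot : Set
  Slot = (Fin j × Fin s) ⊎ Fin t

  -- The Boolean is a variable with an equation, so that matching on it computes the type of the
  -- vertex.
  slot′ : ∀ (i : Fin (suc j)) b → (toℕ i <ᵇ j) ≡ b → Fin (if b then s else t) → Slot
  slot′ i true  eq v = inj₁ (fromℕ< (<ᵇ⇒< (toℕ i) j (subst T (sym eq) tt)) , v)
  slot′ i false eq v = inj₂ v

  slot : KVert (suc j) s t → Slot
  slot (i , v) = slot′ i (toℕ i <ᵇ j) refl v

  class : Slot → ℕ
  class (inj₁ (i , _)) = toℕ i
  class (inj₂ _)       = j

  class-slot′ : ∀ i b eq v → class (slot′ i b eq v) ≡ toℕ i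
  class-slot′ i true  eq v = Fin.toℕ-fromℕ< _
  class-slot′ i false eq v = ≤-antisym
    (≮⇒≥ λ i<j → subst T eq (<⇒<ᵇ i<j)) (s≤s⁻¹ (Fin.toℕ<n i))

  slot′-injective : ∀ i b eq v v′ → slot′ i b eq v ≡ slot′ i b eq v′ → v ≡ v′
  slot′-injective i true  eq v v′ refl = refl
  slot′-injective i false eq v v′ refl = refl

  slot-injective : ∀ u u′ → slot u ≡ slot u′ → u ≡ u′
  slot-injective (i , v) (i′ , v′) eq
    with refl ← Fin.toℕ-injective (trans (sym (class-slot′ i _ refl v))
                  (trans (cong class eq) (class-slot′ i′ _ refl v′)))
    = cong (i ,_) (slot′-injective i _ refl v v′ eq)

  class<⇒inj₁ : ∀ (u : Slot) (l : Fin j) → class u ≡ toℕ l → ∃ λ d → u ≡ inj₁ (l , d)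
  class<⇒inj₁ (inj₁ (i , d)) l eq = d , cong (λ i → inj₁ (i , d)) (Fin.toℕ-injective eq)
  class<⇒inj₁ (inj₂ _)       l eq = contradiction (sym eq) (<⇒≢ (Fin.toℕ<n l))

  class≡⇒inj₂ : ∀ (u : Slot) → class u ≡ j → ∃ λ b → u ≡ inj₂ b
  class≡⇒inj₂ (inj₁ (i , _)) eq = contradiction eq (<⇒≢ (Fin.toℕ<n i))
  class≡⇒inj₂ (inj₂ b)       _  = b , refl

  module _ {n : ℕ} (G : RGraph (suc j) n) where

    -- Forgets the order of coordinates: the tuples found carry the t-vertex at position `i₀`,
    -- whereas `KVert` lists that class last. Only the image has to agree.
    data TransversalEdge (V : Slot → Fin n) (c : Fin j → Fin s) (b : Fin t) : Set where
      transversal : (g : Fin (suc j) → Fin n) → image g ∈ edges G →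
        (∀ i → (∃ λ l → g i ≡ V (inj₁ (l , c l))) ⊎ g i ≡ V (inj₂ b)) →
        (∀ l → ∃ λ i → V (inj₁ (l , c l)) ≡ g i) → (∃ λ i → V (inj₂ b) ≡ g i) →
        TransversalEdge V c b

    disjoint-copies : ∀ {k} (V : Fin k → Slot → Fin n) →
      (∀ a a′ u u′ → V a u ≡ V a′ u′ → a ≡ a′ × u ≡ u′) →
      (∀ a c b → TransversalEdge (V a) c b) → HasDisjointCopies G k s t
    disjoint-copies {k} V V-inj edge = φ , φ-inj , φ-edge
      where
      φ : Fin k × KVert (suc j) s t → Fin n
      φ (a , u) = V a (slot u)
      φ-inj : ∀ {p p′} → φ p ≡ φ p′ → p ≡ p′
      φ-inj {a , u} {a′ , u′} eq =
        let a≡ , u≡ = V-inj a a′ _ _ eq in cong₂ _,_ a≡ (slot-injective u u′ u≡)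
      φ-edge : ∀ a (c : (i : Fin (suc j)) → Fin (classSize (suc j) s t i)) →
        image (λ i → φ (a , i , c i)) ∈ edges G
      φ-edge a c = from (edge a (proj₁ ∘ S-slot) (proj₁ T-slot))
        where
        S-slot : ∀ l → ∃ λ d → slot (inject₁ l , c (inject₁ l)) ≡ inj₁ (l , d)
        S-slot l = class<⇒inj₁ _ l
          (trans (class-slot′ (inject₁ l) _ refl (c (inject₁ l))) (Fin.toℕ-inject₁ l))
        T-slot : ∃ λ b → slot (fromℕ j , c (fromℕ j)) ≡ inj₂ b
        T-slot = class≡⇒inj₂ _ (trans (class-slot′ (fromℕ j) _ refl (c (fromℕ j))) (Fin.toℕ-fromℕ j))
        from : TransversalEdge (V a) (proj₁ ∘ S-slot) (proj₁ T-slot) → _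
        from (transversal g g∈ g⇒V S⇒g T⇒g) = subst (_∈ edges G) (sym (image-⊆⊇ _ into onto)) g∈
          where
          into : ∀ i → φ (a , i , c i) ∈ₛ image g
          into i with view i
          ... | ‵fromℕ = subst (_∈ₛ image g)
            (trans (sym (proj₂ T⇒g)) (cong (V a) (sym (proj₂ T-slot)))) (∈-image⁺ g (proj₁ T⇒g))
          ... | ‵inject₁ l = subst (_∈ₛ image g)
            (trans (sym (proj₂ (S⇒g l))) (cong (V a) (sym (proj₂ (S-slot l))))) (∈-image⁺ g (proj₁ (S⇒g l)))
          onto : ∀ {y} → y ∈ₛ image g → ∃ λ i → y ≡ φ (a , i , c i)
          onto y∈ with ∈-image⁻ g y∈
          ... | i , refl with g⇒V i
          ...   | inj₁ (l , eq) = inject₁ l , trans eq (cong (V a) (sym (proj₂ (S-slot l))))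
          ...   | inj₂ eq       = fromℕ j , trans eq (cong (V a) (sym (proj₂ T-slot)))

-- Copies with empty and with nonempty s-classes

module _ {j n : ℕ} (G : RGraph (suc j) n) where

  kt≤n : ∀ k t → t ^ suc j ≤ n → (6 * suc j * k) ^ suc j * n ≤ edgeCount G → k * t ≤ n
  kt≤n k t t^r≤n many = ≤-trans (*-monoˡ-≤ t (m≤n*m k (6 * suc j)))
    (^-cancelʳ-≤ j {6 * suc j * k * t} {n} (begin
      (6 * r * k * t) ^ r          ≡⟨ ^-distribʳ-* r (6 * r * k) t ⟩
      (6 * r * k) ^ r * t ^ r      ≤⟨ *-monoʳ-≤ ((6 * r * k) ^ r) t^r≤n ⟩
      (6 * r * k) ^ r * n          ≤⟨ many ⟩
      edgeCount G                  ≤⟨ m≤m*n (edgeCount G) (r !) {{r !≢0}} ⟩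
      edgeCount G * r !          ≤⟨ edgeCount*r!≤n^r G ⟩
      n ^ r                        ∎))
    where
    open ≤-Reasoning
    r = suc j

  -- The s-classes exist since j ≥ 1 and are empty, so there is no transversal to check, and k t
  -- distinct vertices suffice.
  empty-copies : ∀ k t → 1 ≤ j → k * t ≤ n → HasDisjointCopies G k 0 t
  empty-copies k t 1≤j kt≤n = disjoint-copies G V V-inj λ _ c _ → contradiction (c (fromℕ< 1≤j)) λ ()
    where
    V : Fin k → Slot → Fin n
    V a (inj₁ (_ , ()))
    V a (inj₂ b) = inject≤ (combine a b) kt≤n
    V-inj : ∀ a a′ u u′ → V a u ≡ V a′ u′ → a ≡ a′ × u ≡ u′
    V-inj a a′ (inj₁ (_ , ())) u′ eq
    V-inj a a′ (inj₂ b) (inj₁ (_ , ())) eq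
    V-inj a a′ (inj₂ b) (inj₂ b′) eq =
      let a≡ , b≡ = Fin.combine-injective a b a′ b′ (Fin.inject≤-injective kt≤n kt≤n _ _ eq)
      in a≡ , cong inj₂ b≡

  module _ (1≤j : 1 ≤ j) (N≤n : threshold j ≤ n) (k s t t′ : ℕ)
           (M^p≤ : (n ^ suc j) ^ ((12 * suc s) ^ j) ≤ n * edgeCount G ^ ((12 * suc s) ^ j))
           (t^r≤n : suc t ^ suc j ≤ n) (many : (6 * suc j * k) ^ suc j * n ≤ edgeCount G) where

    nonempty-copies : t′ ≤ suc t → HasDisjointCopies G k (suc s) t′
    nonempty-copies t′≤t = from (copies j 1≤j n N≤n G k s t M^p≤ t^r≤n many)
      where
      from : Copies j 1≤j n N≤n G k s t M^p≤ t^r≤n many → _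
      from (i₀ , f , S , T , S-inj , T-inj , spec) = disjoint-copies G V V-inj edge
        where
        x : ∀ a → (Fin j → Fin (suc s)) → Fin (suc t) → Vec (Fin n) (suc j)
        x a c b = place i₀ (λ i → S a i (c i)) (T a b)
        -- A constant choice gives a rainbow tuple through the vertex, which reveals its colour.
        -- Colours separate vertices of different classes, within a copy and across copies.
        colour-S : ∀ a i d → f (S a i d) ≡ punchIn i₀ i
        colour-S a i d = trans (cong f (sym (lookup-place i₀ _ _ i)))
          (proj₁ (spec a (λ _ → d) zero) (punchIn i₀ i))
        colour-T : ∀ a b → f (T a b) ≡ i₀
        colour-T a b = trans (cong f (sym (lookup-place-i₀ i₀ (λ i → S a i zero) _)))
          (proj₁ (spec a (λ _ → zero) b) i₀)
        V : Fin k → Slot → Fin n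
        V a (inj₁ (i , d)) = S a i d
        V a (inj₂ b)       = T a (inject≤ b t′≤t)
        S≢T : ∀ {a a′ i d b} → S a i d ≢ T a′ b
        S≢T {a} {a′} {i} {d} {b} eq = Fin.punchInᵢ≢i i₀ i
          (trans (sym (colour-S a i d)) (trans (cong f eq) (colour-T a′ b)))
        V-inj : ∀ a a′ u u′ → V a u ≡ V a′ u′ → a ≡ a′ × u ≡ u′
        V-inj a a′ (inj₁ (i , d)) (inj₁ (i′ , d′)) eq
          with refl ← Fin.punchIn-injective i₀ i i′
                 (trans (sym (colour-S a i d)) (trans (cong f eq) (colour-S a′ i′ d′)))
          = map₂ (cong (λ d → inj₁ (i , d))) (S-inj i a a′ d d′ eq)
        V-inj a a′ (inj₁ _) (inj₂ _) eq = contradiction eq S≢T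
        V-inj a a′ (inj₂ _) (inj₁ _) eq = contradiction (sym eq) S≢T
        V-inj a a′ (inj₂ b) (inj₂ b′) eq =
          map₂ (cong inj₂ ∘ Fin.inject≤-injective t′≤t t′≤t b b′) (T-inj a a′ _ _ eq)
        edge : ∀ a c b → TransversalEdge G (V a) c b
        edge a c b = transversal (lookup (x a c b′)) (proj₂ (spec a c b′)) split
          (λ l → punchIn i₀ l , sym (lookup-place i₀ _ _ l))
          (i₀ , sym (lookup-place-i₀ i₀ (λ i → S a i (c i)) _))
          where
          b′ = inject≤ b t′≤t
          split : ∀ i → (∃ λ l → lookup (x a c b′) i ≡ S a l (c l)) ⊎ lookup (x a c b′) i ≡ T a b′
          split i with i₀ Fin.≟ i
          ... | yes refl = inj₂ (lookup-place-i₀ i₀ (λ i → S a i (c i)) _)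
          ... | no i₀≢i  = inj₁ (punchOut i₀≢i ,
            trans (cong (lookup (x a c b′)) (sym (Fin.punchIn-punchOut i₀≢i))) (lookup-place i₀ _ _ (punchOut i₀≢i)))

theoremA3 : (r : ℕ) → 2 ≤ r →
    ∃[ N ] ∀ (n : ℕ) → N ≤ n → (G : RGraph r n) →
    n ^ (r * 6 ^ (r ∸ 1) ∸ 1) ≤ edgeCount G ^ (6 ^ (r ∸ 1)) →
    ∀ (k s t : ℕ) →
    n ^ (r * (12 * s) ^ (r ∸ 1)) ≤ n * edgeCount G ^ ((12 * s) ^ (r ∸ 1)) →
    t ^ r ≤ n →
    (6 * r * k) ^ r * n ≤ edgeCount G →
    HasDisjointCopies G k s t
theoremA3 (suc j) (s≤s 1≤j) = threshold j , main
  where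
  main : ∀ n → threshold j ≤ n → (G : RGraph (suc j) n) → _ → ∀ k s t →
    n ^ (suc j * (12 * s) ^ j) ≤ n * edgeCount G ^ ((12 * s) ^ j) →
    t ^ suc j ≤ n → (6 * suc j * k) ^ suc j * n ≤ edgeCount G → HasDisjointCopies G k s t
  main n N≤n G _ k zero t _ t^r≤n many = empty-copies G k t 1≤j (kt≤n G k t t^r≤n many)
  main n N≤n G _ k (suc s) t n^rp≤ t^r≤n many with t
  -- K_r(s,…,s,0) has no transversals, so it is embedded as a part of K_r(s,…,s,1).
  ... | zero  = nonempty-copies G 1≤j N≤n k s 0 0 M^p≤ 1^r≤n many z≤n
    where
    M^p≤ = ≤-trans (≤-reflexive (^-*-assoc n (suc j) ((12 * suc s) ^ j))) n^rp≤
    1^r≤n : 1 ^ suc j ≤ n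
    1^r≤n = ≤-trans (≤-reflexive (^-zeroˡ (suc j))) (≤-trans (m≤n+m 1 _) N≤n)
  ... | suc t = nonempty-copies G 1≤j N≤n k s t (suc t) M^p≤ t^r≤n many ≤-refl
    where
    M^p≤ = ≤-trans (≤-reflexive (^-*-assoc n (suc j) ((12 * suc s) ^ j))) n^rp≤
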